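{- Let $c:\mathbb{N}\to\mathbb{R}_+$. Suppose that for every number of agents $k$ there is an asynchronous collective tree exploration (ACTE) algorithm with $k$ agents that explores any tree with $n$ nodes and depth $D$ in at most $\mathcal{O}(c(k)(n+kD))$ moves (with a constant in $\mathcal{O}(\cdot)$ independent of $k,n,D$). Then $c(k)=\Omega(\log^2 k)$.
   Context: ACTE model. An unknown finite rooted tree is to be explored by $k$ agents, all initially located at the root. Exploration proceeds in rounds; at each round an omniscient adversary (knowing the algorithm, the tree, and the state of all agents) selects one agent, which (1) observes the nodes adjacent to its position, (2) takes part in one round of unrestricted all-to-all communication with all other agents (so the team may be controlled centrally), and (3) moves along an edge to a neighbouring node. Each round counts as one move. A node is visited once an agent located at it has been activated; exploration finishes at the first round at which all nodes are visited. An algorithm explores a tree in at most $M$ moves if, against every adversary, exploration finishes within $M$ rounds. The depth is the maximum distance from the root to a node. The lower bound applies a fortiori to the distributed model where communication is only through whiteboards at nodes.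
   Formalization: The function c takes nonnegative rational values instead of nonnegative real values, and the constants in O(·) and Ω(·) are rational. -}

module Defs where

open import Data.Nat as ℕ using (ℕ; zero; suc; _⊔_; _<ᵇ_)
open import Data.Nat.Logarithm using (⌊log₂_⌋)
open import Data.Integer using (+_)
open import Data.Rational as ℚ using (ℚ; _/_; 0ℚ)
open import Data.Fin using (Fin; _≟_)
open import Data.Bool using (Bool; true; false; if_then_else_)
open import Data.List using (List; []; _∷_; reverse; upTo; map; length; _++_; [_])
open import Data.List.Membership.Propositional using (_∈_)
open import Data.Maybe using (Maybe; just; nothing)
open import Data.Product using (_×_; _,_; ∃; Σ; ∃-syntax)
open import Relation.Nullary.Decidable using (does)
open import Relation.Binary.PropositionalEquality using (_≡_)

-- Finite rooted trees (children ordered = port numbers)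

data Tree : Set where
  node : List Tree → Tree

mutual
  size : Tree → ℕ
  size (node ts) = suc (sizeL ts)

  sizeL : List Tree → ℕ
  sizeL []       = 0
  sizeL (t ∷ ts) = size t ℕ.+ sizeL ts

mutual
  depth : Tree → ℕ
  depth (node ts) = depthL ts

  depthL : List Tree → ℕ
  depthL []       = 0
  depthL (t ∷ ts) = suc (depth t) ⊔ depthL ts

nth : {A : Set} → List A → ℕ → Maybe A
nth []       _       = nothing
nth (x ∷ xs) zero    = just x
nth (x ∷ xs) (suc i) = nth xs i

subF : Tree → List ℕ → Maybe Tree
subF t [] = just t
subF (node ts) (i ∷ is) with nth ts i
... | nothing = nothing
... | just s  = subF s is

-- Positions are stored as REVERSED paths: the head is the last child index,
-- so the parent of (i ∷ p) is p, and [] is the root.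
Pos : Set
Pos = List ℕ

sub : Tree → Pos → Maybe Tree
sub t p = subF t (reverse p)

IsNode : Tree → Pos → Set
IsNode t p = ∃[ s ] (sub t p ≡ just s)

nChildren : Tree → Pos → ℕ
nChildren t p with sub t p
... | nothing        = 0
... | just (node ts) = length ts

neighbours : Pos → ℕ → List Pos
neighbours []      c = map (λ i → i ∷ []) (upTo c)
neighbours (j ∷ p) c = p ∷ map (λ i → i ∷ j ∷ p) (upTo c)

-- choose neighbour number m (any out-of-range choice is read as the first
-- neighbour; if there is no neighbour at all the agent stays)
pick : Pos → List Pos → ℕ → Pos
pick here []       _       = here
pick here (x ∷ xs) zero    = x
pick here (x ∷ xs) (suc m) with nth xs m
... | just y  = y
... | nothing = x

-- Observation history: for each round so far, the activated agent and the
-- number of children of the node it observed.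
History : ℕ → Set
History k = List (Fin k × ℕ)

-- An algorithm maps the whole history (including the current round's
-- activated agent and observation) to the index of the neighbour to move to.
Algorithm : ℕ → Set
Algorithm k = History k → ℕ

-- Since algorithms are deterministic, an omniscient adaptive adversary is
-- equivalent to a fixed sequence of agent activations.
Adversary : ℕ → Set
Adversary k = ℕ → Fin k

record State (k : ℕ) : Set where
  constructor st
  field
    pos     : Fin k → Pos
    hist    : History k
    visited : List Pos
open State public

initial : (k : ℕ) → State k
initial k = st (λ _ → []) [] []

update : {k : ℕ} → (Fin k → Pos) → Fin k → Pos → Fin k → Pos
update f a p b = if does (a ≟ b) then p else f b

step : {k : ℕ} → Tree → Algorithm k → Fin k → State k → State k
step t alg a (st ps h vis) =
  let here = ps a
      c    = nChildren t here
      h'   = h ++ [ (a , c) ]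
      to   = pick here (neighbours here c) (alg h')
  in st (update ps a to) h' (here ∷ vis)

run : {k : ℕ} → Tree → Algorithm k → Adversary k → ℕ → State k
run t alg adv zero    = initial _
run t alg adv (suc r) = step t alg (adv r) (run t alg adv r)

ExploresWithin : {k : ℕ} → Algorithm k → Tree → ℕ → Set
ExploresWithin {k} alg t M =
  (adv : Adversary k) (p : Pos) → IsNode t p → p ∈ visited (run t alg adv M)

toℚ : ℕ → ℚ
toℚ n = (+ n) / 1

ExploresInAtMost : {k : ℕ} → Algorithm k → Tree → ℚ → Set
ExploresInAtMost alg t x = ∃[ M ] ((toℚ M ℚ.≤ x) × ExploresWithin alg t M)

{-# OPTIONS --safe #-}
module Submission where

-- The adversary grows the tree while it is explored: giving children to an unvisited leaf is invisible to the algorithm.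
-- Agents waiting on designated unvisited leaves are never activated; all others are, until they reach such a leaf.
-- By induction on w, with lengths measured in units of V² edges, the adversary advances a leaf by m units so that every
-- agent that stays pays (V+w)² m, while the tree grows by at most 64^w nodes per edge of progress.
-- For the step from rate v² to (v+1)², two branches of current lengths L and R are extended by games of rate v² that are so
-- short that walking over to the other branch is never cheaper than staying.  With h a fixed length, the branch to extend is
-- chosen so that the number of agents on it is at least the fraction 1/2 ∓ (L-R)/h of those present; this makes the
-- cost grow by v²/2 per unit plus the decrease of (v²/2h)(L-R)² plus a second-order term, the derandomised form of
-- extending a random branch.  Once |L-R| or min(L,R) is large, the longer branch is abandoned: the cost already exceeds
-- (v+1)² min(L,R).  Since only v ~ √rate is gained per level, log k levels give rate log² k, with n ≤ O(kD).
open import Defs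
open import Data.Nat
open import Data.Nat.Properties
open import Data.Nat.DivMod using (m/n*n≤m; m≡m%n+[m/n]*n; m%n<n; /-monoˡ-≤; m*n/n≡m)
open import Data.Nat.Induction using (<-rec)
open import Data.Nat.Logarithm using (⌊log₂_⌋; ⌊log₂⌊n/2⌋⌋≡⌊log₂n⌋∸1)
open import Data.Nat.Tactic.RingSolver using (solve-∀)
import Data.Nat.Coprimality as Coprime
open import Data.Integer as ℤ using (-[1+_])
import Data.Integer.Properties as ℤ
open import Data.Rational as ℚ using (ℚ; mkℚ; 0ℚ; 1ℚ)
import Data.Rational.Properties as ℚ
open import Data.Bool using (if_then_else_)
open import Data.Empty using (⊥-elim)
open import Data.Fin as Fin using (Fin)
import Data.Fin.Properties as Fin
open import Data.List using (List; []; _∷_; _++_; _∷ʳ_; length; reverse; replicate; upTo; map)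
open import Data.List.Properties using (≡-dec; ++-assoc; ++-cancelˡ; ∷-injectiveˡ; length-++; length-replicate; length-reverse; reverse-++; unfold-reverse; reverse-involutive; reverse-injective)
open import Data.List.Membership.Propositional using (_∈_; _∉_)
open import Data.List.Relation.Unary.All as All using (All; []; _∷_)
import Data.List.Relation.Unary.All.Properties as All
open import Data.List.Relation.Unary.Any using (here; there)
open import Data.Maybe using (Maybe; just; nothing)
open import Data.Product using (_×_; _,_; proj₁; proj₂; swap; ∃-syntax; Σ-syntax)
open import Data.Sum as Sum using (_⊎_; inj₁; inj₂)
open import Data.Unit using (⊤; tt)
open import Function using (_∘_; case_of_)
open import Relation.Binary.PropositionalEquality
open import Relation.Nullary using (¬_; Dec; yes; no; does)
open import Relation.Nullary.Decidable using (dec-true; dec-false)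
open import Algebra.Properties.Semiring.Sum +-*-semiring using (sum; ∑-distrib-+; *-distribˡ-sum; *-distribʳ-sum; sum-cong-≗)

-- Trees grown at a leaf

-- An agent need not accept the game on its branch: it may walk to another designated leaf. The
-- promise of a strategy is therefore a lower bound on the moves by a sum over agents, charging the
-- full rate to an agent on the advanced leaf but only the walking distance to one that ended
-- elsewhere. Such promises compose: in consecutive advances the distances from the intermediate
-- leaf cancel. Two demands pull at the length `m` of an inner game. It must be short, so that
-- leaving is no bargain and the branch lengths stay comparable, yet long, because the second-order
-- gain is quadratic in `m`. A length of order `V² y / (κ v²)`, with `y` the shorter branch and
-- `κ = 32`, meets both. In units of `V²` edges a bare path already has rate `V²`, so the induction
-- starts from `V`; a large `V` is the slack that absorbs the losses of every level. The guaranteed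
-- length `E` may grow with `w` at will: it is a common factor of moves, size and depth, and
-- cancels. An algorithm that keeps its agents away from all designated leaves only spends moves, so
-- nothing is assumed about agents ever arriving.

leaf : Tree
leaf = node []

mutual
  growF : ℕ → Tree → List ℕ → Tree
  growF c (node ts) []       = node (replicate c leaf)
  growF c (node ts) (i ∷ p) = node (growL c ts i p)

  growL : ℕ → List Tree → ℕ → List ℕ → List Tree
  growL c []       i       p = []
  growL c (t ∷ ts) zero    p = growF c t p ∷ ts
  growL c (t ∷ ts) (suc i) p = t ∷ growL c ts i p

-- `sel` exposes the with-abstraction of `subF` as a function of the selected child.
sel : Maybe Tree → List ℕ → Maybe Tree
sel nothing  p = nothing
sel (just s) p = subF s p

subF-∷ : ∀ ts i p → subF (node ts) (i ∷ p) ≡ sel (nth ts i) p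
subF-∷ ts i p with nth ts i
... | nothing = refl
... | just s  = refl

subF-++ : ∀ t {s} p q → subF t p ≡ just s → subF t (p ++ q) ≡ subF s q
subF-++ t [] q refl = refl
subF-++ (node ts) (i ∷ p) q eq with nth ts i
... | just s′ = subF-++ s′ p q eq

arity : Maybe Tree → ℕ
arity nothing          = 0
arity (just (node ts)) = length ts

nChildren-arity : ∀ t p → nChildren t p ≡ arity (sub t p)
nChildren-arity t p with sub t p
... | nothing        = refl
... | just (node ts) = refl

nth-replicate : ∀ c j → nth (replicate c leaf) j ≡ nothing ⊎ nth (replicate c leaf) j ≡ just leaf
nth-replicate zero    j       = inj₁ refl
nth-replicate (suc c) zero    = inj₂ refl
nth-replicate (suc c) (suc j) = nth-replicate c j

nth-replicate-< : ∀ {c j} → j < c → nth (replicate c leaf) j ≡ just leaf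
nth-replicate-< {suc c} {zero}  _         = refl
nth-replicate-< {suc c} {suc j} (s≤s j<c) = nth-replicate-< j<c

length-growL : ∀ c ts i p → length (growL c ts i p) ≡ length ts
length-growL c []       i       p = refl
length-growL c (t ∷ ts) zero    p = refl
length-growL c (t ∷ ts) (suc i) p = cong suc (length-growL c ts i p)

nth-growL-≢ : ∀ c ts i p {j} → i ≢ j → nth (growL c ts i p) j ≡ nth ts j
nth-growL-≢ c []       i       p         i≢j = refl
nth-growL-≢ c (t ∷ ts) zero    p {zero}  i≢j = ⊥-elim (i≢j refl)
nth-growL-≢ c (t ∷ ts) zero    p {suc j} i≢j = refl
nth-growL-≢ c (t ∷ ts) (suc i) p {zero}  i≢j = refl
nth-growL-≢ c (t ∷ ts) (suc i) p {suc j} i≢j = nth-growL-≢ c ts i p (i≢j ∘ cong suc)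

nth-growL-≡ : ∀ c ts i p {s} → nth ts i ≡ just s → nth (growL c ts i p) i ≡ just (growF c s p)
nth-growL-≡ c (t ∷ ts) zero    p refl = refl
nth-growL-≡ c (t ∷ ts) (suc i) p eq   = nth-growL-≡ c ts i p eq

leaf-∷ : ∀ ts i p → subF (node ts) (i ∷ p) ≡ just leaf → ∃[ s ] (nth ts i ≡ just s × subF s p ≡ just leaf)
leaf-∷ ts i p eq with nth ts i
... | just s = s , refl , eq

arity-subF-replicate : ∀ c j q → arity (subF (node (replicate c leaf)) (j ∷ q)) ≡ 0
arity-subF-replicate c j q rewrite subF-∷ (replicate c leaf) j q with nth-replicate c j
... | inj₁ eq rewrite eq = refl
... | inj₂ eq rewrite eq with q
...   | []    = refl
...   | _ ∷ _ = refl

subF-growF-≡ : ∀ c t p → subF t p ≡ just leaf → subF (growF c t p) p ≡ just (node (replicate c leaf))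
subF-growF-≡ c (node ts) []      eq = refl
subF-growF-≡ c (node ts) (i ∷ p) eq with leaf-∷ ts i p eq
... | s , nth≡ , eq′ rewrite subF-∷ (growL c ts i p) i p | nth-growL-≡ c ts i p nth≡ = subF-growF-≡ c s p eq′

-- Arity is all that an observation reveals. It is 0 outside the tree, so a new leaf below `p` is
-- indistinguishable from the missing node that was there before.
arity-growF-≢ : ∀ c t p q → subF t p ≡ just leaf → q ≢ p → arity (subF (growF c t p) q) ≡ arity (subF t q)
arity-growF-≢ c (node ts) []      []      eq q≢p = ⊥-elim (q≢p refl)
arity-growF-≢ c (node []) []      (j ∷ q) eq q≢p = arity-subF-replicate c j q
arity-growF-≢ c (node ts) (i ∷ p) []      eq q≢p = length-growL c ts i p
arity-growF-≢ c (node ts) (i ∷ p) (j ∷ q) eq q≢p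
  rewrite subF-∷ (growL c ts i p) j q | subF-∷ ts j q with i ≟ j
... | no i≢j rewrite nth-growL-≢ c ts i p i≢j = refl
... | yes refl with leaf-∷ ts i p eq
...   | s , nth≡ , eq′ rewrite nth-growL-≡ c ts i p nth≡ | nth≡ = arity-growF-≢ c s p q eq′ (q≢p ∘ cong (i ∷_))

leaf-growF-≢ : ∀ c t p q → subF t p ≡ just leaf → subF t q ≡ just leaf → q ≢ p →
               subF (growF c t p) q ≡ just leaf
leaf-growF-≢ c (node ts) []      []      eq leafq q≢p = ⊥-elim (q≢p refl)
leaf-growF-≢ c (node []) []      (j ∷ q) eq ()    q≢p
leaf-growF-≢ c (node []) (i ∷ p) []      ()
leaf-growF-≢ c (node ts) (i ∷ p) (j ∷ q) eq leafq q≢p with i ≟ j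
... | no i≢j rewrite subF-∷ (growL c ts i p) j q | nth-growL-≢ c ts i p i≢j = trans (sym (subF-∷ ts j q)) leafq
... | yes refl with leaf-∷ ts i p eq
...   | s , nth≡ , eq′ rewrite subF-∷ (growL c ts i p) i q | nth-growL-≡ c ts i p nth≡ =
        leaf-growF-≢ c s p q eq′ (trans (sym (trans (subF-∷ ts i q) (cong (λ z → sel z q) nth≡))) leafq) (q≢p ∘ cong (i ∷_))

sizeL-replicate : ∀ c → sizeL (replicate c leaf) ≡ c
sizeL-replicate zero    = refl
sizeL-replicate (suc c) = cong suc (sizeL-replicate c)

mutual
  size-growF : ∀ c t p → subF t p ≡ just leaf → size (growF c t p) ≡ size t + c
  size-growF c (node []) []      eq = cong suc (sizeL-replicate c)
  size-growF c (node ts) (i ∷ p) eq with leaf-∷ ts i p eq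
  ... | s , nth≡ , eq′ = cong suc (size-growL c ts i p nth≡ eq′)

  size-growL : ∀ c ts i p {s} → nth ts i ≡ just s → subF s p ≡ just leaf →
               sizeL (growL c ts i p) ≡ sizeL ts + c
  size-growL c (t ∷ ts) zero    p refl eq rewrite size-growF c t p eq =
    trans (+-assoc (size t) c _) (trans (cong (size t +_) (+-comm c _)) (sym (+-assoc (size t) _ c)))
  size-growL c (t ∷ ts) (suc i) p nth≡ eq rewrite size-growL c ts i p nth≡ eq = sym (+-assoc (size t) _ c)

depthL-replicate : ∀ c → depthL (replicate c leaf) ≤ 1
depthL-replicate zero    = z≤n
depthL-replicate (suc c) = ⊔-lub ≤-refl (depthL-replicate c)

mutual
  depth-growF : ∀ c t p → depth (growF c t p) ≤ depth t ⊔ suc (length p)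
  depth-growF c (node ts) []      = ≤-trans (depthL-replicate c) (m≤n⊔m _ 1)
  depth-growF c (node ts) (i ∷ p) = depth-growL c ts i p

  depth-growL : ∀ c ts i p → depthL (growL c ts i p) ≤ depthL ts ⊔ suc (suc (length p))
  depth-growL c []       i       p = z≤n
  depth-growL c (t ∷ ts) zero    p = ⊔-lub {z = depthL ts}
    (≤-trans (s≤s (depth-growF c t p)) (⊔-monoˡ-≤ (2 + length p) (m≤m⊔n (suc (depth t)) (depthL ts))))
    (≤-trans (m≤n⊔m (suc (depth t)) (depthL ts)) (m≤m⊔n (suc (depth t) ⊔ depthL ts) (2 + length p)))
  depth-growL c (t ∷ ts) (suc i) p = ⊔-lub {z = depthL (growL c ts i p)}
    (≤-trans (m≤m⊔n (suc (depth t)) (depthL ts)) (m≤m⊔n (suc (depth t) ⊔ depthL ts) (2 + length p)))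
    (≤-trans (depth-growL c ts i p) (⊔-monoˡ-≤ (2 + length p) (m≤n⊔m (suc (depth t)) (depthL ts))))

grow : ℕ → Tree → Pos → Tree
grow c t p = growF c t (reverse p)

IsLeaf : Tree → Pos → Set
IsLeaf t p = sub t p ≡ just leaf

nChildren-grow : ∀ c t p q → IsLeaf t p → q ≢ p → nChildren (grow c t p) q ≡ nChildren t q
nChildren-grow c t p q leafp q≢p =
  trans (nChildren-arity (grow c t p) q)
    (trans (arity-growF-≢ c t (reverse p) (reverse q) leafp (q≢p ∘ reverse-injective))
      (sym (nChildren-arity t q)))

IsLeaf-grow : ∀ c t p q → IsLeaf t p → IsLeaf t q → q ≢ p → IsLeaf (grow c t p) q
IsLeaf-grow c t p q leafp leafq q≢p =
  leaf-growF-≢ c t (reverse p) (reverse q) leafp leafq (q≢p ∘ reverse-injective)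

IsLeaf-child : ∀ {c i} t p → IsLeaf t p → i < c → IsLeaf (grow c t p) (i ∷ p)
IsLeaf-child {c} {i} t p leafp i<c rewrite unfold-reverse i p =
  trans (subF-++ (grow c t p) (reverse p) (i ∷ []) (subF-growF-≡ c t (reverse p) leafp))
    (trans (subF-∷ (replicate c leaf) i []) (cong (λ z → sel z []) (nth-replicate-< i<c)))

size-grow : ∀ c t p → IsLeaf t p → size (grow c t p) ≡ size t + c
size-grow c t p = size-growF c t (reverse p)

depth-grow : ∀ c t p → depth (grow c t p) ≤ depth t ⊔ suc (length p)
depth-grow c t p = subst (λ n → depth (grow c t p) ≤ depth t ⊔ suc n) (length-reverse p) (depth-growF c t (reverse p))

-- The tree metric

distF : List ℕ → List ℕ → ℕ
distF []      q       = length q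
distF (a ∷ p) []      = suc (length p)
distF (a ∷ p) (b ∷ q) with a ≟ b
... | yes _ = distF p q
... | no  _ = suc (length p) + suc (length q)

dist : Pos → Pos → ℕ
dist p q = distF (reverse p) (reverse q)

-- Paths are stored from the node up to the root, so prepending `w` descends: `q` lies in the
-- subtree of `p`, possibly at `p` itself.
Below : Pos → Pos → Set
Below p q = ∃[ w ] q ≡ w ++ p

distF-∷ : ∀ a p q → distF (a ∷ p) (a ∷ q) ≡ distF p q
distF-∷ a p q with a ≟ a
... | yes _  = refl
... | no a≢a = ⊥-elim (a≢a refl)

distF-≢ : ∀ {a b} p q → a ≢ b → distF (a ∷ p) (b ∷ q) ≡ suc (length p) + suc (length q)
distF-≢ {a} {b} p q a≢b with a ≟ b
... | yes a≡b = ⊥-elim (a≢b a≡b)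
... | no _    = refl

distF-refl : ∀ p → distF p p ≡ 0
distF-refl []      = refl
distF-refl (a ∷ p) = trans (distF-∷ a p p) (distF-refl p)

-- Two inequalities, because a move may go down this edge or up.
distF-∷ʳ : ∀ p q i → distF p (q ∷ʳ i) ≤ suc (distF p q) × distF p q ≤ suc (distF p (q ∷ʳ i))
distF-∷ʳ [] q i rewrite length-++ q {i ∷ []} | +-comm (length q) 1 = ≤-refl , m≤n⇒m≤1+n (n≤1+n _)
distF-∷ʳ (a ∷ p) [] i with a ≟ i
... | no _ rewrite +-comm (length p) 1 = ≤-refl , m≤n⇒m≤1+n (n≤1+n _)
... | yes refl with p
...   | []     = z≤n , ≤-refl
...   | b ∷ p′ = m≤n⇒m≤1+n (n≤1+n _) , ≤-refl
distF-∷ʳ (a ∷ p) (b ∷ q) i with a ≟ b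
... | yes refl = distF-∷ʳ p q i
... | no _ rewrite length-++ q {i ∷ []} | +-comm (length q) 1 | +-suc (length p) (suc (length q)) =
  ≤-refl , m≤n⇒m≤1+n (n≤1+n _)

distF-++ʳ : ∀ p w → distF p (p ++ w) ≡ length w
distF-++ʳ []      w = refl
distF-++ʳ (a ∷ p) w = trans (distF-∷ a p (p ++ w)) (distF-++ʳ p w)

-- The path from below `p` to a position outside its subtree passes through `p`. This additivity
-- later prices an agent that abandons a branch.
distF-escape : ∀ p w q → (∀ u → q ≢ p ++ u) → distF (p ++ w) q ≡ length w + distF p q
distF-escape []      w q       q≢ = ⊥-elim (q≢ q refl)
distF-escape (a ∷ p) w []      q≢ rewrite length-++ p {w} =
  trans (cong suc (+-comm (length p) _)) (sym (+-suc (length w) (length p)))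
distF-escape (a ∷ p) w (b ∷ q) q≢ with a ≟ b
... | yes refl = distF-escape p w q (λ u → q≢ u ∘ cong (a ∷_))
... | no _ rewrite length-++ p {w} | +-comm (length p) (length w) | +-suc (length w) (length p + suc (length q)) =
  cong suc (+-assoc (length w) (length p) (suc (length q)))

distF-fork : ∀ p {a b} u w → a ≢ b →
             distF (p ++ a ∷ u) (p ++ b ∷ w) ≡ suc (length u) + suc (length w)
distF-fork []      u w a≢b = distF-≢ u w a≢b
distF-fork (c ∷ p) u w a≢b = trans (distF-∷ c _ _) (distF-fork p u w a≢b)

dist-refl : ∀ p → dist p p ≡ 0
dist-refl p = distF-refl (reverse p)

dist-child : ∀ p q i → dist p (i ∷ q) ≤ suc (dist p q) × dist p q ≤ suc (dist p (i ∷ q))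
dist-child p q i rewrite unfold-reverse i q = distF-∷ʳ (reverse p) (reverse q) i

dist-below : ∀ p w → dist p (w ++ p) ≡ length w
dist-below p w rewrite reverse-++ w p = trans (distF-++ʳ (reverse p) (reverse w)) (length-reverse w)

dist-escape : ∀ p w q → ¬ Below p q → dist (w ++ p) q ≡ length w + dist p q
dist-escape p w q ¬below rewrite reverse-++ w p =
  trans (distF-escape (reverse p) (reverse w) (reverse q) λ u eq → ¬below (reverse u , unreverse u eq))
    (cong (_+ dist p q) (length-reverse w))
  where
  unreverse : ∀ u → reverse q ≡ reverse p ++ u → q ≡ reverse u ++ p
  unreverse u eq = trans (sym (reverse-involutive q))
    (trans (cong reverse eq) (trans (reverse-++ (reverse p) u) (cong (reverse u ++_) (reverse-involutive p))))

reverse-fork : ∀ (p : Pos) c z → reverse (z ++ c ∷ p) ≡ reverse p ++ c ∷ reverse z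
reverse-fork p c z = trans (reverse-++ z (c ∷ p))
  (trans (cong (_++ reverse z) (unfold-reverse c p)) (++-assoc (reverse p) (c ∷ []) (reverse z)))

dist-fork : ∀ p {a b} u w → a ≢ b → dist (u ++ a ∷ p) (w ++ b ∷ p) ≡ suc (length u) + suc (length w)
dist-fork p {a} {b} u w a≢b
  rewrite reverse-fork p a u | reverse-fork p b w | sym (length-reverse u) | sym (length-reverse w) =
  distF-fork (reverse p) (reverse u) (reverse w) a≢b

-- Read from the root, both paths begin with that of `p` and then continue with `a` and `b`, so
-- neither can be a prefix of the other.
fork-¬Below : ∀ p {a b} u w → a ≢ b → ¬ Below (u ++ a ∷ p) (w ++ b ∷ p)
fork-¬Below p {a} {b} u w a≢b (z , eq) = a≢b (sym (∷-injectiveˡ (++-cancelˡ (reverse p) _ _ forward)))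
  where
  forward : reverse p ++ b ∷ reverse w ≡ reverse p ++ a ∷ (reverse u ++ reverse z)
  forward = trans (sym (reverse-fork p b w)) (trans (cong reverse eq) (trans (reverse-++ z (u ++ a ∷ p))
    (trans (cong (_++ reverse z) (reverse-fork p a u)) (++-assoc (reverse p) (a ∷ reverse u) (reverse z)))))

¬Below-++ : ∀ p w {q} → ¬ Below p q → ¬ Below (w ++ p) q
¬Below-++ p w ¬below (u , eq) = ¬below (u ++ w , trans eq (sym (++-assoc u w p)))

-- Runs on a tree that is still being grown

sum-mono : ∀ {n} {f g : Fin n → ℕ} → (∀ i → f i ≤ g i) → sum f ≤ sum g
sum-mono {zero}  f≤g = z≤n
sum-mono {suc n} f≤g = +-mono-≤ (f≤g Fin.zero) (sum-mono (f≤g ∘ Fin.suc))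

sum-zero : ∀ {n} {f : Fin n → ℕ} → (∀ i → f i ≡ 0) → sum f ≡ 0
sum-zero {zero}  f≡0 = refl
sum-zero {suc n} f≡0 rewrite f≡0 Fin.zero = sum-zero (f≡0 ∘ Fin.suc)

-- The effect of one round on the travelled distances: only the activated agent `a` moves, along one
-- edge.
sum-mono-bump : ∀ {n} {f g : Fin n → ℕ} a → (∀ i → a ≢ i → f i ≤ g i) → f a ≤ suc (g a) →
                sum f ≤ suc (sum g)
sum-mono-bump Fin.zero    f≤g fa≤ = +-mono-≤ fa≤ (sum-mono λ i → f≤g (Fin.suc i) λ ())
sum-mono-bump {f = f} {g} (Fin.suc a) f≤g fa≤ = ≤-trans
  (+-mono-≤ (f≤g Fin.zero λ ()) (sum-mono-bump a (λ i a≢i → f≤g (Fin.suc i) (a≢i ∘ Fin.suc-injective)) fa≤))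
  (≤-reflexive (+-suc (g Fin.zero) _))

_≟ₚ_ : (p q : Pos) → Dec (p ≡ q)
_≟ₚ_ = ≡-dec _≟_

open import Data.List.Membership.DecPropositional _≟ₚ_ using (_∈?_)

nth-All : ∀ {A : Set} {P : A → Set} {x} xs m → All P xs → nth xs m ≡ just x → P x
nth-All (x ∷ xs) zero    (px ∷ _)   refl = px
nth-All (x ∷ xs) (suc m) (_  ∷ pxs) eq   = nth-All xs m pxs eq

-- Covers the defaults as well: an out-of-range choice means the first neighbour, and an agent
-- without neighbours stays at `p`.
pick-All : ∀ {P : Pos → Set} {p} qs m → P p → All P qs → P (pick p qs m)
pick-All []       m       pp _          = pp
pick-All (q ∷ qs) zero    pp (pq ∷ _)   = pq
pick-All (q ∷ qs) (suc m) pp (pq ∷ pqs) with nth qs m in eq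
... | just _  = nth-All qs m pqs eq
... | nothing = pq

dist-pick : ∀ x p c m → dist x (pick p (neighbours p c) m) ≤ suc (dist x p)
dist-pick x p c m = pick-All (neighbours p c) m (n≤1+n _) (near p)
  where
  children : ∀ q → All (λ z → dist x z ≤ suc (dist x q)) (map (_∷ q) (upTo c))
  children q = All.map⁺ (All.universal (λ i → proj₁ (dist-child x q i)) (upTo c))
  near : ∀ q → All (λ z → dist x z ≤ suc (dist x q)) (neighbours q c)
  near []      = children []
  near (j ∷ q) = proj₂ (dist-child x q j) ∷ children (j ∷ q)

update-≡ : ∀ {k} (f : Fin k → Pos) a p → update f a p a ≡ p
update-≡ f a p with a Fin.≟ a
... | yes _  = refl
... | no a≢a = ⊥-elim (a≢a refl)

update-≢ : ∀ {k} (f : Fin k → Pos) {a b} p → a ≢ b → update f a p b ≡ f b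
update-≢ f {a} {b} p a≢b with a Fin.≟ b
... | yes a≡b = ⊥-elim (a≢b a≡b)
... | no _    = refl

-- The game on live leaves, limited by size `S`, depth `Δ` and a goal of `Target` moves.

module Play {k : ℕ} (alg : Algorithm k) (S Δ Target : ℕ) where

  -- Schedules list the most recent activation first.
  runL : Tree → List (Fin k) → State k
  runL t []      = initial k
  runL t (a ∷ s) = step t alg a (runL t s)

  Live : Tree → List (Fin k) → Pos → Set
  Live t s q = IsLeaf t q × q ∉ visited (runL t s)

  -- The tree enters a round only through the observed number of children, here the parameter `c`.
  stepWith : ℕ → Fin k → State k → State k
  stepWith c a (st ps h vis) =
    let h′ = h ++ (a , c) ∷ []
    in st (update ps a (pick (ps a) (neighbours (ps a) c) (alg h′))) h′ (ps a ∷ vis)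

  -- The children of a node are counted only by an agent activated there, and that activation visits
  -- the node. While `p` is unvisited, no observation and hence no decision depends on its children.
  runL-grow : ∀ c t p → IsLeaf t p → ∀ s → p ∉ visited (runL t s) → runL (grow c t p) s ≡ runL t s
  runL-grow c t p leafp []      p∉ = refl
  runL-grow c t p leafp (a ∷ s) p∉ rewrite runL-grow c t p leafp s (p∉ ∘ there) =
    cong (λ n → stepWith n a (runL t s)) (nChildren-grow c t p _ leafp (λ eq → p∉ (here (sym eq))))

  ParentIn : List Pos → Pos → Set
  ParentIn vis []      = ⊤
  ParentIn vis (j ∷ p) = p ∈ vis

  ParentIn-there : ∀ {q vis} p → ParentIn vis p → ParentIn (q ∷ vis) p
  ParentIn-there []      _  = tt
  ParentIn-there (j ∷ p) p∈ = there p∈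

  -- Both halves need each other: a visited position is a former position of an agent, and an agent
  -- climbing to a visited node needs that node's parent visited. The consequence used later is that
  -- children of an unvisited leaf are unvisited.
  parentsIn : ∀ t s → (∀ i → ParentIn (visited (runL t s)) (pos (runL t s) i)) ×
                      (∀ q → q ∈ visited (runL t s) → ParentIn (visited (runL t s)) q)
  parentsIn t []      = (λ _ → tt) , λ _ ()
  parentsIn t (a ∷ s) = atIn , visIn
    where
    σ = runL t s
    ih = parentsIn t s
    c = nChildren t (pos σ a)
    children : ∀ p → All (ParentIn (p ∷ visited σ)) (map (_∷ p) (upTo c))
    children p = All.map⁺ (All.universal (λ i → here refl) (upTo c))
    near : ∀ p → ParentIn (visited σ) p → All (ParentIn (p ∷ visited σ)) (neighbours p c)
    near []      _  = children []
    near (j ∷ p) p∈ = ParentIn-there p (proj₂ ih p p∈) ∷ children (j ∷ p)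
    atIn : ∀ i → ParentIn (pos σ a ∷ visited σ) (pos (step t alg a σ) i)
    atIn i with a Fin.≟ i
    ... | yes _ = pick-All (neighbours (pos σ a) c) _ (ParentIn-there (pos σ a) (proj₁ ih a)) (near (pos σ a) (proj₁ ih a))
    ... | no _  = ParentIn-there (pos σ i) (proj₁ ih i)
    visIn : ∀ q → q ∈ pos σ a ∷ visited σ → ParentIn (pos σ a ∷ visited σ) q
    visIn q (here refl) = ParentIn-there q (proj₁ ih a)
    visIn q (there q∈)  = ParentIn-there q (proj₂ ih q q∈)

  -- The state is not stored but recomputed by running the whole schedule on the current tree. The
  -- head of `O` is the leaf that gets advanced.
  record Cfg (O : List Pos) : Set where
    constructor cfg
    field
      tree   : Tree
      sched  : List (Fin k)
      live   : All (Live tree sched) O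
      size≤  : size tree ≤ S
      depth≤ : depth tree ≤ Δ
    moves : ℕ
    moves = length sched
    at : Fin k → Pos
    at = pos (runL tree sched)
  open Cfg public

  Parked : ∀ {O} → Cfg O → Set
  Parked {O} c = ∀ i → at c i ∈ O

  Win : Set
  Win = ∃[ t ] ∃[ s ] ∃[ q ] (size t ≤ S × depth t ≤ Δ × Target ≤ length s × Live t s q)

  dist-step : ∀ t a σ x → dist x (pos (step t alg a σ) a) ≤ suc (dist x (pos σ a))
  dist-step t a σ x rewrite update-≡ (pos σ) a (pick (pos σ a) (neighbours (pos σ a) (nChildren t (pos σ a)))
                              (alg (hist σ ++ (a , nChildren t (pos σ a)) ∷ []))) =
    dist-pick x (pos σ a) (nChildren t (pos σ a)) _

  -- A round visits the position that the agent leaves, not the one it reaches; stepping onto a live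
  -- leaf keeps it unvisited.
  activate : ∀ {O} (c : Cfg O) a → at c a ∉ O → Cfg O
  activate c a a∉ = cfg (tree c) (a ∷ sched c) (stillLive a∉ (live c)) (size≤ c) (depth≤ c)
    where
    stillLive : ∀ {O} → at c a ∉ O → All (Live (tree c) (sched c)) O → All (Live (tree c) (a ∷ sched c)) O
    stillLive a∉ []                  = []
    stillLive a∉ ((leafq , q∉) ∷ ls) =
      (leafq , λ { (here eq) → a∉ (here (sym eq)) ; (there q∈) → q∉ q∈ }) ∷ stillLive (a∉ ∘ there) ls

  record Driven {O} (c : Cfg O) : Set where
    constructor driven
    field
      cfg′    : Cfg O
      tree≡   : tree cfg′ ≡ tree c
      parked  : Parked cfg′
      unmoved : ∀ i → at c i ∈ O → at cfg′ i ≡ at c i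
      cost    : moves c + sum (λ i → dist (at c i) (at cfg′ i)) ≤ moves cfg′

  module _ {p O} (c₀ : Cfg (p ∷ O)) where

    driveFrom : ∀ fuel (c : Cfg (p ∷ O)) → Target ≤ fuel + moves c → tree c ≡ tree c₀ →
                (∀ i → at c₀ i ∈ p ∷ O → at c i ≡ at c₀ i) →
                moves c₀ + sum (λ i → dist (at c₀ i) (at c i)) ≤ moves c → Win ⊎ Driven c₀
    -- The agents have spent `Target` moves without all parking. The live leaf `p` is still
    -- unvisited, so the adversary has won already.
    driveFrom zero c target≤ tree≡ unmoved cost =
      inj₁ (tree c , sched c , p , size≤ c , depth≤ c , target≤ , All.head (live c))
    driveFrom (suc fuel) c target≤ tree≡ unmoved cost with Fin.all? (λ i → at c i ∈? (p ∷ O))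
    ... | yes parked = inj₂ (driven c tree≡ parked unmoved cost)
    ... | no ¬parked with Fin.¬∀⟶∃¬ k _ (λ i → at c i ∈? (p ∷ O)) ¬parked
    ...   | a , a∉ = driveFrom fuel (activate c a a∉) (≤-trans target≤ (≤-reflexive (sym (+-suc fuel _)))) tree≡ unmoved′ cost′
      where
      still : ∀ {i} → a ≢ i → at (activate c a a∉) i ≡ at c i
      still a≢i = update-≢ (at c) _ a≢i
      unmoved′ : ∀ i → at c₀ i ∈ p ∷ O → at (activate c a a∉) i ≡ at c₀ i
      unmoved′ i i∈ with a Fin.≟ i
      ... | yes refl = ⊥-elim (a∉ (subst (_∈ p ∷ O) (sym (unmoved i i∈)) i∈))
      ... | no _     = unmoved i i∈
      cost′ : moves c₀ + sum (λ i → dist (at c₀ i) (at (activate c a a∉) i)) ≤ suc (moves c)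
      cost′ = ≤-trans
        (+-monoʳ-≤ (moves c₀) (sum-mono-bump a
          (λ i a≢i → ≤-reflexive (cong (dist (at c₀ i)) (still a≢i)))
          (dist-step (tree c) a (runL (tree c) (sched c)) (at c₀ a))))
        (≤-trans (≤-reflexive (+-suc (moves c₀) _)) (s≤s cost))

    drive : Win ⊎ Driven c₀
    drive = driveFrom Target c₀ (m≤m+n Target _) refl (λ _ _ → refl)
      (≤-reflexive (trans (cong (moves c₀ +_) (sum-zero (λ i → dist-refl (at c₀ i)))) (+-identityʳ _)))

  -- Stronger than being distinct from `p`: an agent going from `p`, or from any later extension of
  -- it, to a leaf of `O` has to leave the subtree of `p`.
  Far : Pos → List Pos → Set
  Far p O = All (λ q → ¬ Below p q) O

  Far-++ : ∀ {p O} w → Far p O → Far (w ++ p) O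
  Far-++ {p} w = All.map (¬Below-++ p w)

  Far-≢ : ∀ {p O q} → Far p O → q ∈ O → q ≢ p
  Far-≢ far q∈ refl = All.lookup far q∈ ([] , refl)

  record Grown {O O′} (c : Cfg O) (n : ℕ) (c′ : Cfg O′) : Set where
    constructor grown
    field
      at≡    : ∀ i → at c′ i ≡ at c i
      moves≡ : moves c′ ≡ moves c
      size≡  : size (tree c′) ≡ size (tree c) + n
  open Grown public

  Grown-trans : ∀ {O₁ O₂ O₃} {c₁ : Cfg O₁} {c₂ : Cfg O₂} {c₃ : Cfg O₃} {m n} →
                Grown c₁ m c₂ → Grown c₂ n c₃ → Grown c₁ (m + n) c₃
  Grown-trans {m = m} {n} (grown a₁ m₁ s₁) (grown a₂ m₂ s₂) =
    grown (λ i → trans (a₂ i) (a₁ i)) (trans m₂ m₁) (trans s₂ (trans (cong (_+ n) s₁) (+-assoc _ m n)))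

  growCfg : ∀ {p O} n (c : Cfg (p ∷ O)) → Far p O → size (tree c) + n ≤ S → suc (length p) ≤ Δ →
            (C : List Pos) → All (λ q → ∃[ i ] (i < n × q ≡ i ∷ p)) C →
            Σ[ c′ ∈ Cfg (C ++ O) ] Grown c n c′
  growCfg {p} {O} n c@(cfg t s ((leafp , p∉) ∷ ls) _ d≤) far room deep C children =
    cfg (grow n t p) s (All.++⁺ (All.map newLive children) (oldLive far ls))
      (≤-trans (≤-reflexive (size-grow n t p leafp)) room)
      (≤-trans (depth-grow n t p) (⊔-lub d≤ deep)) ,
    grown (λ i → cong (λ σ → pos σ i) same) refl (size-grow n t p leafp)
    where
    same : runL (grow n t p) s ≡ runL t s
    same = runL-grow n t p leafp s p∉
    newLive : ∀ {q} → ∃[ i ] (i < n × q ≡ i ∷ p) → Live (grow n t p) s q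
    newLive (i , i<n , refl) = IsLeaf-child t p leafp i<n ,
      λ q∈ → p∉ (proj₂ (parentsIn t s) (i ∷ p) (subst (λ σ → i ∷ p ∈ visited σ) same q∈))
    oldLive : ∀ {O} → Far p O → All (Live t s) O → All (Live (grow n t p) s) O
    oldLive []           []                  = []
    oldLive {q ∷ _} (far ∷ fars) ((leafq , q∉) ∷ ls) =
      (IsLeaf-grow n t p q leafp leafq (λ { refl → far ([] , refl) }) ,
       λ q∈ → q∉ (subst (λ σ → _ ∈ visited σ) same q∈)) ∷ oldLive fars ls

  growPath : ∀ {p O} n (c : Cfg (p ∷ O)) → Far p O → size (tree c) + n ≤ S → length p + n ≤ Δ →
             Σ[ c′ ∈ Cfg ((replicate n 0 ++ p) ∷ O) ] Grown c n c′
  growPath zero c far room deep = c , grown (λ _ → refl) refl (sym (+-identityʳ _))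
  growPath {p} {O} (suc n) c far room deep
    with growPath n c far (≤-trans (+-monoʳ-≤ _ (n≤1+n n)) room) (≤-trans (+-monoʳ-≤ _ (n≤1+n n)) deep)
  ... | c₁ , g₁ with growCfg 1 c₁ (Far-++ (replicate n 0) far) room₁ deep₁ (_ ∷ []) ((0 , s≤s z≤n , refl) ∷ [])
    where
    room₁ : size (tree c₁) + 1 ≤ S
    room₁ = ≤-trans (≤-reflexive (trans (+-comm _ 1) (trans (cong suc (size≡ g₁)) (sym (+-suc _ n))))) room
    deep₁ : suc (length (replicate n 0 ++ p)) ≤ Δ
    deep₁ = ≤-trans (≤-reflexive (trans (cong suc (trans (length-++ (replicate n 0))
      (trans (cong (_+ length p) (length-replicate n)) (+-comm n _)))) (sym (+-suc _ n)))) deep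
  ... | c₂ , g₂ = c₂ , subst (λ m → Grown c m c₂) (+-comm n 1) (Grown-trans g₁ g₂)

  -- The charge for an agent now at q, when the live leaf p has been advanced to p′.  Agents that were parked elsewhere
  -- stay there, so in `cost` below they contribute the same to both sides.
  wt : Pos → ℕ → Pos → Pos → ℕ
  wt p′ ρ p q = if does (q ≟ₚ p′) then ρ else dist p q

  wt-≡ : ∀ p′ ρ p → wt p′ ρ p p′ ≡ ρ
  wt-≡ p′ ρ p with p′ ≟ₚ p′
  ... | yes _ = refl
  ... | no ¬r = ⊥-elim (¬r refl)

  wt-≢ : ∀ {p′ q} ρ p → q ≢ p′ → wt p′ ρ p q ≡ dist p q
  wt-≢ {p′} {q} ρ p q≢ with q ≟ₚ p′
  ... | yes q≡ = ⊥-elim (q≢ q≡)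
  ... | no _   = refl

  -- Strategies that advance one live leaf at a guaranteed rate, in units of `U` edges.

  module Strategies (U : ℕ) where

    record Advance (ρ C m : ℕ) {p O} (c : Cfg (p ∷ O)) : Set where
      field
        p′      : Pos
        w       : List ℕ
        p′≡     : p′ ≡ w ++ p
        length≡ : length w ≡ U * m
        cfg′    : Cfg (p′ ∷ O)
        parked  : Parked cfg′
        unmoved : ∀ i → at c i ≢ p → at cfg′ i ≡ at c i
        growth  : size (tree cfg′) ≤ size (tree c) + C * (U * m)
        cost    : moves c + sum (λ i → wt p′ (ρ * m) p (at cfg′ i)) ≤ moves cfg′ + sum (λ i → dist p (at c i))

    -- The length `m` depends on the behaviour of the agents, so only a range is promised. `C`
    -- bounds the nodes created per edge of progress.
    Strategy : (ρ C lo hi : ℕ) → Set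
    Strategy ρ C lo hi = ∀ {p O} (c : Cfg (p ∷ O)) → Parked c → Far p O →
      length p + U * hi ≤ Δ → size (tree c) + C * (U * hi) ≤ S →
      Win ⊎ (∃[ m ] (lo ≤ m × m ≤ hi × Advance ρ C m c))

    ∈-tail : ∀ {p q : Pos} {O} → q ∈ p ∷ O → q ≢ p → q ∈ O
    ∈-tail (here q≡p) q≢p = ⊥-elim (q≢p q≡p)
    ∈-tail (there q∈) q≢p = q∈

    far-≢ : ∀ {p p′ w q} {O} → Far p O → p′ ≡ w ++ p → q ∈ O → q ≢ p′
    far-≢ {w = w} far p′≡ q∈ q≡p′ = All.lookup far q∈ (w , trans q≡p′ p′≡)

    sum-chain : ∀ {n} {a b : ℕ} (f g h : Fin n → ℕ) → a + sum h ≤ b → (∀ i → f i ≤ h i + g i) →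
                a + sum f ≤ b + sum g
    sum-chain {a = a} {b} f g h a≤b f≤ = begin
      a + sum f             ≤⟨ +-monoʳ-≤ a (sum-mono f≤) ⟩
      a + sum (λ i → h i + g i) ≡⟨ cong (a +_) (∑-distrib-+ h g) ⟩
      a + (sum h + sum g)   ≡⟨ sym (+-assoc a _ _) ⟩
      a + sum h + sum g     ≤⟨ +-monoˡ-≤ (sum g) a≤b ⟩
      b + sum g             ∎
      where open ≤-Reasoning

    -- Reaching the new tip from `p` takes `U` moves per unit, whence the rate. The upper end
    -- `2 * e` only matches the shape of the later levels.
    pathStrategy : ∀ e → Strategy U 1 e (2 * e)
    pathStrategy e {p} {O} c parked far deep room
      with growPath (U * e) c far (≤-trans (+-monoʳ-≤ _ (≤-trans Ue≤ (≤-reflexive (sym (*-identityˡ _))))) room)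
                                  (≤-trans (+-monoʳ-≤ _ Ue≤) deep)
      where
      Ue≤ : U * e ≤ U * (2 * e)
      Ue≤ = *-monoʳ-≤ U (m≤m+n e _)
    ... | c₁ , g with drive c₁
    ...   | inj₁ win = inj₁ win
    ...   | inj₂ (driven c₂ tree≡ parked₂ unmoved₂ cost₂) = inj₂ (e , ≤-refl , m≤m+n e _ , record
      { p′ = p′ ; w = replicate (U * e) 0 ; p′≡ = refl ; length≡ = length-replicate (U * e)
      ; cfg′ = c₂ ; parked = parked₂ ; unmoved = still
      ; growth = ≤-reflexive (trans (cong size tree≡) (trans (size≡ g) (cong (size (tree c) +_) (sym (*-identityˡ _)))))
      ; cost = sum-chain _ _ (λ i → dist (at c i) (at c₂ i)) cost₁ bound })
      where
      p′ = replicate (U * e) 0 ++ p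
      cost₁ : moves c + sum (λ i → dist (at c i) (at c₂ i)) ≤ moves c₂
      cost₁ = subst₂ (λ n f → n + f ≤ moves c₂) (moves≡ g) (sum-cong-≗ (λ i → cong (λ q → dist q (at c₂ i)) (at≡ g i))) cost₂
      still : ∀ i → at c i ≢ p → at c₂ i ≡ at c i
      still i i≢ = trans (unmoved₂ i (there (subst (_∈ O) (sym (at≡ g i)) (∈-tail (parked i) i≢)))) (at≡ g i)
      bound : ∀ i → wt p′ (U * e) p (at c₂ i) ≤ dist (at c i) (at c₂ i) + dist p (at c i)
      bound i with at c i ≟ₚ p
      ... | no i≢ rewrite still i i≢ | wt-≢ (U * e) p (far-≢ {w = replicate (U * e) 0} far refl (∈-tail (parked i) i≢)) = m≤n+m _ _
      ... | yes i≡ rewrite i≡ with at c₂ i ≟ₚ p′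
      ...   | yes i≡′ rewrite i≡′ | dist-below p (replicate (U * e) 0) | length-replicate (U * e) {0} = m≤m+n _ _
      ...   | no  _   = m≤m+n _ _

    stay : ∀ ρ C {p O} (c : Cfg (p ∷ O)) → Parked c → Far p O → Advance ρ C 0 c
    stay ρ C {p} {O} c parked far = record
      { p′ = p ; w = [] ; p′≡ = refl ; length≡ = sym (*-zeroʳ U) ; cfg′ = c ; parked = parked
      ; unmoved = λ _ _ → refl ; growth = m≤m+n _ _ ; cost = +-monoʳ-≤ (moves c) (sum-mono bound) }
      where
      bound : ∀ i → wt p (ρ * 0) p (at c i) ≤ dist p (at c i)
      bound i with at c i ≟ₚ p
      ... | yes _ = ≤-trans (≤-reflexive (*-zeroʳ ρ)) z≤n
      ... | no  _ = ≤-refl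

    -- The case with content is an agent that stays for the first advance and leaves in the second:
    -- its walk starts at the intermediate leaf and passes `p`, so it covers `dist p q`.
    advance-trans : ∀ {ρ C m₁ m₂ p O} {c : Cfg (p ∷ O)} → Far p O → Parked c →
                    (A : Advance ρ C m₁ c) → Advance ρ C m₂ (Advance.cfg′ A) → Advance ρ C (m₁ + m₂) c
    advance-trans {ρ} {C} {m₁} {m₂} {p} {O} {c} far parked₀ A B = record
      { p′ = B.p′ ; w = B.w ++ A.w ; p′≡ = p″≡
      ; length≡ = trans (length-++ B.w) (trans (cong₂ _+_ B.length≡ A.length≡) (trans (+-comm (U * m₂) _) (sym (*-distribˡ-+ U m₁ m₂))))
      ; cfg′ = B.cfg′ ; parked = B.parked
      ; unmoved = λ i i≢ → trans (B.unmoved i (≢₁ i i≢)) (A.unmoved i i≢)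
      ; growth = ≤-trans B.growth (≤-trans (+-monoˡ-≤ _ A.growth) (≤-reflexive (growth-eq (size (tree c)) C U m₁ m₂)))
      ; cost = cost″ }
      where
      module A = Advance A
      module B = Advance B
      p″≡ : B.p′ ≡ (B.w ++ A.w) ++ p
      p″≡ = trans B.p′≡ (trans (cong (B.w ++_) A.p′≡) (sym (++-assoc B.w A.w p)))
      growth-eq : ∀ s C U m n → s + C * (U * m) + C * (U * n) ≡ s + C * (U * (m + n))
      growth-eq = solve-∀
      ≢₁ : ∀ i → at c i ≢ p → at A.cfg′ i ≢ A.p′
      ≢₁ i i≢ eq = far-≢ {w = A.w} far A.p′≡ (∈-tail (parked₀ i) i≢) (trans (sym (A.unmoved i i≢)) eq)
      f₁ f₂ f₃ : Fin k → ℕ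
      f₁ i = wt A.p′ (ρ * m₁) p (at A.cfg′ i)
      f₂ i = wt B.p′ (ρ * m₂) A.p′ (at B.cfg′ i)
      f₃ i = wt B.p′ (ρ * (m₁ + m₂)) p (at B.cfg′ i)
      bound : ∀ i → f₃ i + dist A.p′ (at A.cfg′ i) ≤ f₁ i + f₂ i
      bound i with at A.cfg′ i ≟ₚ A.p′
      ... | no i≢ rewrite B.unmoved i i≢ | wt-≢ (ρ * m₂) A.p′ (far-≢ {w = B.w ++ A.w} far p″≡ (∈-tail (A.parked i) i≢))
                        | wt-≢ (ρ * (m₁ + m₂)) p (far-≢ {w = B.w ++ A.w} far p″≡ (∈-tail (A.parked i) i≢)) = ≤-refl
      ... | yes i≡ rewrite i≡ | dist-refl A.p′ with at B.cfg′ i ≟ₚ B.p′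
      ...   | yes _ = ≤-reflexive (trans (+-identityʳ _) (*-distribˡ-+ ρ m₁ m₂))
      ...   | no i≢ = begin
        dist p q + 0                 ≡⟨ +-identityʳ _ ⟩
        dist p q                     ≤⟨ m≤n+m _ (length A.w) ⟩
        length A.w + dist p q        ≡⟨ sym (dist-escape p A.w q (All.lookup far (∈-tail (B.parked i) i≢))) ⟩
        dist (A.w ++ p) q            ≡⟨ cong (λ z → dist z q) (sym A.p′≡) ⟩
        dist A.p′ q                  ≤⟨ m≤n+m _ (ρ * m₁) ⟩
        ρ * m₁ + dist A.p′ q         ∎
        where
        open ≤-Reasoning
        q = at B.cfg′ i
      cost″ : moves c + sum f₃ ≤ moves B.cfg′ + sum (λ i → dist p (at c i))
      cost″ = +-cancelʳ-≤ (sum (λ i → dist A.p′ (at A.cfg′ i))) _ _ (begin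
        moves c + sum f₃ + D₁                  ≡⟨ +-assoc (moves c) _ _ ⟩
        moves c + (sum f₃ + D₁)                ≡⟨ cong (moves c +_) (sym (∑-distrib-+ f₃ (λ i → dist A.p′ (at A.cfg′ i)))) ⟩
        moves c + sum (λ i → f₃ i + dist A.p′ (at A.cfg′ i)) ≤⟨ +-monoʳ-≤ (moves c) (sum-mono bound) ⟩
        moves c + sum (λ i → f₁ i + f₂ i)      ≡⟨ cong (moves c +_) (∑-distrib-+ f₁ f₂) ⟩
        moves c + (sum f₁ + sum f₂)            ≡⟨ sym (+-assoc (moves c) _ _) ⟩
        moves c + sum f₁ + sum f₂              ≤⟨ +-monoˡ-≤ (sum f₂) A.cost ⟩
        moves A.cfg′ + D₀ + sum f₂             ≡⟨ swap₃ (moves A.cfg′) D₀ (sum f₂) ⟩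
        moves A.cfg′ + sum f₂ + D₀             ≤⟨ +-monoˡ-≤ D₀ B.cost ⟩
        moves B.cfg′ + D₁ + D₀                 ≡⟨ swap₃ (moves B.cfg′) D₁ D₀ ⟩
        moves B.cfg′ + D₀ + D₁                 ∎)
        where
        open ≤-Reasoning
        D₀ = sum (λ i → dist p (at c i))
        D₁ = sum (λ i → dist A.p′ (at A.cfg′ i))
        swap₃ : ∀ a b c → a + b + c ≡ a + c + b
        swap₃ = solve-∀

    -- Stopping as soon as `e` units are reached overshoots by at most one round, hence by at most
    -- `E ≤ e`. Every round gains a unit, so fuel `e` suffices.
    repeat : ∀ {ρ C E} → Strategy ρ C 1 E → ∀ {e} → E ≤ e → Strategy ρ C e (2 * e)
    repeat {ρ} {C} {E} round {e} E≤e {p} {O} c parked far deep room =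
      loop e 0 (m≤n+m e 0) z≤n (stay ρ C c parked far)
      where
      loop : ∀ fuel m → e ≤ m + fuel → m ≤ 2 * e → Advance ρ C m c →
             Win ⊎ (∃[ m ] (e ≤ m × m ≤ 2 * e × Advance ρ C m c))
      loop zero m e≤ m≤ A = inj₂ (m , ≤-trans e≤ (≤-reflexive (+-identityʳ m)) , m≤ , A)
      loop (suc fuel) m e≤ m≤ A with e ≤? m
      ... | yes e≤m = inj₂ (m , e≤m , m≤ , A)
      ... | no  e≰m with round A.cfg′ A.parked far′ deep′ room′
        where
        module A = Advance A
        m+E≤ : m + E ≤ 2 * e
        m+E≤ = +-mono-≤ (<⇒≤ (≰⇒> e≰m)) (≤-trans E≤e (m≤m+n e 0))
        far′ : Far A.p′ O
        far′ = subst (λ q → Far q O) (sym A.p′≡) (Far-++ A.w far)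
        deep′ : length A.p′ + U * E ≤ Δ
        deep′ = begin
          length A.p′ + U * E             ≡⟨ cong (_+ U * E) (trans (cong length A.p′≡) (trans (length-++ A.w) (cong (_+ length p) A.length≡))) ⟩
          U * m + length p + U * E        ≡⟨ eq U m (length p) E ⟩
          length p + U * (m + E)          ≤⟨ +-monoʳ-≤ (length p) (*-monoʳ-≤ U m+E≤) ⟩
          length p + U * (2 * e)          ≤⟨ deep ⟩
          Δ                               ∎
          where
          open ≤-Reasoning
          eq : ∀ U m l E → U * m + l + U * E ≡ l + U * (m + E)
          eq = solve-∀
        room′ : size (tree A.cfg′) + C * (U * E) ≤ S
        room′ = begin
          size (tree A.cfg′) + C * (U * E)              ≤⟨ +-monoˡ-≤ _ A.growth ⟩
          size (tree c) + C * (U * m) + C * (U * E)     ≡⟨ eq (size (tree c)) C U m E ⟩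
          size (tree c) + C * (U * (m + E))             ≤⟨ +-monoʳ-≤ (size (tree c)) (*-monoʳ-≤ C (*-monoʳ-≤ U m+E≤)) ⟩
          size (tree c) + C * (U * (2 * e))             ≤⟨ room ⟩
          S                                             ∎
          where
          open ≤-Reasoning
          eq : ∀ s C U m E → s + C * (U * m) + C * (U * E) ≡ s + C * (U * (m + E))
          eq = solve-∀
      ...   | inj₁ win = inj₁ win
      ...   | inj₂ (m₂ , 1≤m₂ , m₂≤E , B) = loop fuel (m + m₂)
        (≤-trans e≤ (≤-trans (+-monoʳ-≤ m (+-monoˡ-≤ fuel 1≤m₂)) (≤-reflexive (sym (+-assoc m m₂ fuel)))))
        (+-mono-≤ (<⇒≤ (≰⇒> e≰m)) (≤-trans m₂≤E (≤-trans E≤e (m≤m+n e 0))))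
        (advance-trans far parked A B)

-- The arithmetic of one level

module Numbers (c V v E : ℕ) (32≤c : 32 ≤ c) (384c≤V : 384 * c ≤ V) (V≤v : V ≤ v) (1≤E : 1 ≤ E) where

  -- Both branches start with length y₀ and a round ends once the shorter one has length y₁ or the lengths differ by h/2;
  -- h ~ y₁/√rate and y₀ ~ h balance the head start paid at rate V² against the second-order gain.  Z clears denominators.
  abstract
    A y₀ h y₁ Z : ℕ
    A  = 64 * (c * c)
    y₀ = 16 * c * (v * v) * (V * E)
    h  = c * y₀
    y₁ = 32 * (c * c * c) * (v * v * v) * E
    Z  = 2 * A * h

    A≡ : A ≡ 64 * (c * c)
    A≡ = refl
    h≡ : h ≡ c * y₀
    h≡ = refl
    Z≡ : Z ≡ 2 * A * h
    Z≡ = refl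

    -- The factor `V` in `y₀` makes `2 c v h / V` an integer. `y₁` is this quotient, a length at
    -- which the second-order gain covers all losses.
    y₁V≡ : y₁ * V ≡ 2 * c * v * h
    y₁V≡ = eq c V v E
      where
      eq : ∀ c V v E → 32 * (c * c * c) * (v * v * v) * E * V ≡ 2 * c * v * (c * (16 * c * (v * v) * (V * E)))
      eq = solve-∀

    y₀≡ : y₀ ≡ 16 * c * (v * v) * (V * E)
    y₀≡ = refl

  1≤c : 1 ≤ c
  1≤c = ≤-trans (s≤s z≤n) 32≤c

  c≤V : c ≤ V
  c≤V = ≤-trans (m≤n*m c 384) 384c≤V

  1≤V : 1 ≤ V
  1≤V = ≤-trans 1≤c c≤V

  1≤v : 1 ≤ v
  1≤v = ≤-trans 1≤V V≤v

  instance
    c≢0 : NonZero c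
    c≢0 = >-nonZero 1≤c
    V≢0 : NonZero V
    V≢0 = >-nonZero 1≤V
    v≢0 : NonZero v
    v≢0 = >-nonZero 1≤v
    E≢0 : NonZero E
    E≢0 = >-nonZero 1≤E
    v²≢0 : NonZero (v * v)
    v²≢0 = m*n≢0 v v
    VE≢0 : NonZero (V * E)
    VE≢0 = m*n≢0 V E
    16c≢0 : NonZero (16 * c)
    16c≢0 = m*n≢0 16 c
    16cv²≢0 : NonZero (16 * c * (v * v))
    16cv²≢0 = m*n≢0 (16 * c) (v * v)

  1≤y₀ : 1 ≤ y₀
  1≤y₀ rewrite y₀≡ = >-nonZero⁻¹ _ {{m*n≢0 (16 * c * (v * v)) (V * E)}}

  1≤h : 1 ≤ h
  1≤h rewrite h≡ = *-mono-≤ 1≤c 1≤y₀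

  instance
    h≢0 : NonZero h
    h≢0 = >-nonZero 1≤h
    A≢0 : NonZero A
    A≢0 rewrite A≡ = m*n≢0 64 (c * c) {{_}} {{m*n≢0 c c}}
    Z≢0 : NonZero Z
    Z≢0 rewrite Z≡ = m*n≢0 (2 * A) h {{m*n≢0 2 A}}

  2y₀≤y₁ : 2 * y₀ ≤ y₁
  2y₀≤y₁ = *-cancelʳ-≤ (2 * y₀) y₁ V (begin
    2 * y₀ * V          ≤⟨ *-mono-≤ (*-monoʳ-≤ 2 (m≤n*m y₀ c)) V≤v ⟩
    2 * (c * y₀) * v    ≡⟨ cong (λ z → 2 * z * v) (sym h≡) ⟩
    2 * h * v           ≤⟨ m≤m*n (2 * h * v) c ⟩
    2 * h * v * c       ≡⟨ eq c h v ⟩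
    2 * c * v * h       ≡⟨ sym y₁V≡ ⟩
    y₁ * V              ∎)
    where
    open ≤-Reasoning
    eq : ∀ c h v → 2 * h * v * c ≡ 2 * c * v * h
    eq = solve-∀

  y₀≤y₁ : y₀ ≤ y₁
  y₀≤y₁ = ≤-trans (m≤m+n y₀ _) 2y₀≤y₁

  -- With d = L - R, gain - loss is Z times the per-agent bound
  --   v²(L+R)/2 - (v² - V²)y₀ + V²((L+R)² - 4y₀²)/Z - (v²/2h) d².
  gain loss : ℕ → ℕ → ℕ
  gain L R = A * h * (v * v) * (L + R) + V * V * ((L + R) * (L + R)) + 2 * A * (v * v) * (L * R) + 2 * A * h * (V * V) * y₀
  loss L R = 2 * A * h * (v * v) * y₀ + 4 * (V * V) * (y₀ * y₀) + A * (v * v) * (L * L + R * R)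

  gain-comm : ∀ L R → gain L R ≡ gain R L
  gain-comm L R rewrite +-comm L R | *-comm L R = refl

  loss-comm : ∀ L R → loss L R ≡ loss R L
  loss-comm L R rewrite +-comm (L * L) (R * R) = refl

  -- The head start: at equal lengths `y₀` the bound per agent is exactly the walk of `V² y₀` edges
  -- to a tip.
  loss+initial≡gain : loss y₀ y₀ + Z * (V * V * y₀) ≡ gain y₀ y₀
  loss+initial≡gain rewrite Z≡ = eq A h v V y₀
    where
    eq : ∀ A h v V y → (2 * A * h * (v * v) * y + 4 * (V * V) * (y * y) + A * (v * v) * (y * y + y * y)) + 2 * A * h * (V * V * y)
       ≡ A * h * (v * v) * (y + y) + V * V * ((y + y) * (y + y)) + 2 * A * (v * v) * (y * y) + 2 * A * h * (V * V) * y
    eq = solve-∀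

  -- With `d = L - R`, `v² (L+R)/2 - v² y₀ - v² d²/(2h)` equals `v² (R - y₀) + v² d (h - d)/(2h)`.
  -- Writing `R = y₀ + t`, `L = R + δ`, `h = δ + g` turns the whole difference into a polynomial
  -- with nonnegative coefficients. Hence the truncated `gain ∸ loss` is exact.
  loss≤gain-sorted : ∀ {L R} → y₀ ≤ R → R ≤ L → L ≤ R + h → loss L R ≤ gain L R
  loss≤gain-sorted {L} {R} y₀≤R R≤L L≤R+h
    with m≤n⇒∃[o]m+o≡n y₀≤R | m≤n⇒∃[o]m+o≡n R≤L
  ... | t , refl | δ , refl with m≤n⇒∃[o]m+o≡n (+-cancelˡ-≤ (y₀ + t) δ h L≤R+h)
  ... | g , δ+g≡h = ≤-trans (m≤m+n _ _) (≤-reflexive (subst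
        (λ z → 2 * A * z * (v * v) * y₀ + 4 * (V * V) * (y₀ * y₀) + A * (v * v) * ((y₀ + t + δ) * (y₀ + t + δ) + (y₀ + t) * (y₀ + t))
           + (2 * A * z * (v * v) * t + A * (v * v) * (g * δ) + V * V * (2 * t + δ) * (4 * y₀ + 2 * t + δ) + 2 * A * z * (V * V) * y₀)
           ≡ A * z * (v * v) * (y₀ + t + δ + (y₀ + t)) + V * V * ((y₀ + t + δ + (y₀ + t)) * (y₀ + t + δ + (y₀ + t)))
             + 2 * A * (v * v) * ((y₀ + t + δ) * (y₀ + t)) + 2 * A * z * (V * V) * y₀)
        δ+g≡h (eq A v V y₀ t δ g)))
    where
    eq : ∀ A v V y t δ g →
      2 * A * (δ + g) * (v * v) * y + 4 * (V * V) * (y * y) + A * (v * v) * ((y + t + δ) * (y + t + δ) + (y + t) * (y + t))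
           + (2 * A * (δ + g) * (v * v) * t + A * (v * v) * (g * δ) + V * V * (2 * t + δ) * (4 * y + 2 * t + δ) + 2 * A * (δ + g) * (V * V) * y)
           ≡ A * (δ + g) * (v * v) * (y + t + δ + (y + t)) + V * V * ((y + t + δ + (y + t)) * (y + t + δ + (y + t)))
             + 2 * A * (v * v) * ((y + t + δ) * (y + t)) + 2 * A * (δ + g) * (V * V) * y
    eq = solve-∀

  -- A round continues only while the lengths differ by less than `h/2`, and one extension adds at
  -- most `h/4`; hence `3h/4`.
  Balanced : ℕ → ℕ → Set
  Balanced L R = 4 * L ≤ 4 * R + 3 * h × 4 * R ≤ 4 * L + 3 * h

  balanced⇒≤ : ∀ {L R} → 4 * L ≤ 4 * R + 3 * h → L ≤ R + h
  balanced⇒≤ {L} {R} 4L≤ = *-cancelˡ-≤ 4 (≤-trans 4L≤ (≤-trans (+-monoʳ-≤ (4 * R) (*-monoˡ-≤ h (n≤1+n 3))) (≤-reflexive (sym (*-distribˡ-+ 4 R h)))))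

  -- Of the `a` agents at the two tips, `x` are on the branch that grows. The second hypothesis says
  -- `x/a ≥ 1/2 - (L-R)/h`, which pays the first-order change of the bound. Squaring the difference
  -- leaves a surplus `v² m²/(2h)`, and by `small` it pays for the growth of `V² (L+R)²/Z`.
  step-bound : ∀ {a x L R m} → V * V * (2 * (L + R) + m) ≤ A * (v * v) * m →
               a * h + 2 * (a * R) ≤ 2 * (a * L) + 2 * (h * x) →
               a * gain (L + m) R + a * loss L R ≤ a * gain L R + a * loss (L + m) R + Z * (v * v * m * x)
  step-bound {a} {x} {L} {R} {m} small choice rewrite Z≡ = begin
    a * gain (L + m) R + a * loss L R
      ≡⟨ eq₁ A h v V y₀ a L R m ⟩
    a * gain L R + a * loss L R + a * m * (V * V * (2 * (L + R) + m)) + A * (v * v) * m * (a * h + 2 * (a * R))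
      ≤⟨ +-mono-≤ (+-monoʳ-≤ (a * gain L R + a * loss L R) (*-monoʳ-≤ (a * m) small)) (*-monoʳ-≤ (A * (v * v) * m) choice) ⟩
    a * gain L R + a * loss L R + a * m * (A * (v * v) * m) + A * (v * v) * m * (2 * (a * L) + 2 * (h * x))
      ≡⟨ eq₂ A h v V y₀ a x L R m ⟩
    a * gain L R + a * loss (L + m) R + 2 * A * h * (v * v * m * x) ∎
    where
    open ≤-Reasoning
    eq₁ : ∀ A h v V y a L R m →
      a * (A * h * (v * v) * (L + m + R) + V * V * ((L + m + R) * (L + m + R)) + 2 * A * (v * v) * ((L + m) * R) + 2 * A * h * (V * V) * y)
      + a * (2 * A * h * (v * v) * y + 4 * (V * V) * (y * y) + A * (v * v) * (L * L + R * R))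
      ≡ a * (A * h * (v * v) * (L + R) + V * V * ((L + R) * (L + R)) + 2 * A * (v * v) * (L * R) + 2 * A * h * (V * V) * y)
      + a * (2 * A * h * (v * v) * y + 4 * (V * V) * (y * y) + A * (v * v) * (L * L + R * R))
      + a * m * (V * V * (2 * (L + R) + m)) + A * (v * v) * m * (a * h + 2 * (a * R))
    eq₁ = solve-∀
    eq₂ : ∀ A h v V y a x L R m →
      a * (A * h * (v * v) * (L + R) + V * V * ((L + R) * (L + R)) + 2 * A * (v * v) * (L * R) + 2 * A * h * (V * V) * y)
      + a * (2 * A * h * (v * v) * y + 4 * (V * V) * (y * y) + A * (v * v) * (L * L + R * R))
      + a * m * (A * (v * v) * m) + A * (v * v) * m * (2 * (a * L) + 2 * (h * x))
      ≡ a * (A * h * (v * v) * (L + R) + V * V * ((L + R) * (L + R)) + 2 * A * (v * v) * (L * R) + 2 * A * h * (V * V) * y)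
      + a * (2 * A * h * (v * v) * y + 4 * (V * V) * (y * y) + A * (v * v) * ((L + m) * (L + m) + R * R))
      + 2 * A * h * (v * v * m * x)
    eq₂ = solve-∀

  -- Of `(v+1)² y` the part `v² y` is already contained in `v² (L+R)/2`; what is left to pay is
  -- `(2v+1) y` and the losses. The head start `V² y₀` is given away.
  core⇒stop : ∀ y δ →
    2 * A * h * (v * v) * y₀ + 4 * (V * V) * (y₀ * y₀) + A * (v * v) * (δ * δ) + 2 * A * h * (2 * v + 1) * y
      ≤ A * h * (v * v) * δ + V * V * ((2 * y + δ) * (2 * y + δ)) →
    loss (y + δ) y + Z * ((suc v * suc v) * y) ≤ gain (y + δ) y
  core⇒stop y δ core rewrite Z≡ = begin
    loss (y + δ) y + 2 * A * h * ((suc v * suc v) * y)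
      ≡⟨ eq₁ A h v V y₀ y δ ⟩
    2 * A * h * (v * v) * y + 2 * A * (v * v) * ((y + δ) * y) +
    (2 * A * h * (v * v) * y₀ + 4 * (V * V) * (y₀ * y₀) + A * (v * v) * (δ * δ) + 2 * A * h * (2 * v + 1) * y)
      ≤⟨ +-monoʳ-≤ (2 * A * h * (v * v) * y + 2 * A * (v * v) * ((y + δ) * y)) (≤-trans core (m≤m+n _ (2 * A * h * (V * V) * y₀))) ⟩
    2 * A * h * (v * v) * y + 2 * A * (v * v) * ((y + δ) * y) +
    (A * h * (v * v) * δ + V * V * ((2 * y + δ) * (2 * y + δ)) + 2 * A * h * (V * V) * y₀)
      ≡⟨ eq₂ A h v V y₀ y δ ⟩
    gain (y + δ) y ∎
    where
    open ≤-Reasoning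
    eq₁ : ∀ A h v V y₀ y δ →
      2 * A * h * (v * v) * y₀ + 4 * (V * V) * (y₀ * y₀) + A * (v * v) * ((y + δ) * (y + δ) + y * y) + 2 * A * h * ((suc v * suc v) * y)
      ≡ 2 * A * h * (v * v) * y + 2 * A * (v * v) * ((y + δ) * y) +
        (2 * A * h * (v * v) * y₀ + 4 * (V * V) * (y₀ * y₀) + A * (v * v) * (δ * δ) + 2 * A * h * (2 * v + 1) * y)
    eq₁ = solve-∀
    eq₂ : ∀ A h v V y₀ y δ →
      2 * A * h * (v * v) * y + 2 * A * (v * v) * ((y + δ) * y) +
      (A * h * (v * v) * δ + V * V * ((2 * y + δ) * (2 * y + δ)) + 2 * A * h * (V * V) * y₀)
      ≡ A * h * (v * v) * (y + δ + y) + V * V * ((y + δ + y) * (y + δ + y)) + 2 * A * (v * v) * ((y + δ) * y) + 2 * A * h * (V * V) * y₀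
    eq₂ = solve-∀

  2v+1≤3v : 2 * v + 1 ≤ 3 * v
  2v+1≤3v = ≤-trans (+-monoʳ-≤ (2 * v) 1≤v) (≤-reflexive (eq v))
    where
    eq : ∀ v → 2 * v + v ≡ 3 * v
    eq = solve-∀

  -- For `δ` between `h/2` and `3h/4`, `v² δ/2 - v² δ²/(2h)` is at least `v² δ/8`. Being of order
  -- `v² h`, this covers `v² y₀` because `32 y₀ ≤ h`, and `(2v+1) y` because `y ≤ 2 y₁`. The
  -- constants 32 and 384 originate here.
  stop-unbalanced : ∀ {y δ} → y₀ ≤ y → y ≤ 2 * y₁ → h ≤ 2 * δ → 4 * δ ≤ 3 * h →
                    loss (y + δ) y + Z * ((suc v * suc v) * y) ≤ gain (y + δ) y
  stop-unbalanced {y} {δ} y₀≤y y≤2y₁ h≤2δ 4δ≤3h = core⇒stop y δ (begin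
    2 * A * h * (v * v) * y₀ + 4 * (V * V) * (y₀ * y₀) + A * (v * v) * (δ * δ) + 2 * A * h * (2 * v + 1) * y
      ≡⟨ eq₁ A h v V y₀ y δ ⟩
    A * (2 * h * (v * v) * y₀ + v * v * (δ * δ) + 2 * h * (2 * v + 1) * y) + V * V * ((2 * y₀) * (2 * y₀))
      ≤⟨ +-mono-≤ (*-monoʳ-≤ A main) (*-monoʳ-≤ (V * V) (*-mono-≤ 2y₀≤ 2y₀≤)) ⟩
    A * (h * (v * v) * δ) + V * V * ((2 * y + δ) * (2 * y + δ))
      ≡⟨ cong (_+ V * V * ((2 * y + δ) * (2 * y + δ))) (eq₂ A h v δ) ⟩
    A * h * (v * v) * δ + V * V * ((2 * y + δ) * (2 * y + δ)) ∎)
    where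
    open ≤-Reasoning
    eq₁ : ∀ A h v V y₀ y δ →
      2 * A * h * (v * v) * y₀ + 4 * (V * V) * (y₀ * y₀) + A * (v * v) * (δ * δ) + 2 * A * h * (2 * v + 1) * y
      ≡ A * (2 * h * (v * v) * y₀ + v * v * (δ * δ) + 2 * h * (2 * v + 1) * y) + V * V * ((2 * y₀) * (2 * y₀))
    eq₁ = solve-∀
    eq₂ : ∀ A h v δ → A * (h * (v * v) * δ) ≡ A * h * (v * v) * δ
    eq₂ = solve-∀
    2y₀≤ : 2 * y₀ ≤ 2 * y + δ
    2y₀≤ = ≤-trans (*-monoʳ-≤ 2 y₀≤y) (m≤m+n _ δ)
    32y₀≤h : 32 * y₀ ≤ h
    32y₀≤h rewrite h≡ = *-monoˡ-≤ y₀ 32≤c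
    192vy₁≤ : 192 * v * y₁ ≤ v * v * h
    192vy₁≤ = *-cancelʳ-≤ _ _ V (begin
      192 * v * y₁ * V        ≡⟨ *-assoc (192 * v) y₁ V ⟩
      192 * v * (y₁ * V)      ≡⟨ cong (192 * v *_) y₁V≡ ⟩
      192 * v * (2 * c * v * h) ≡⟨ eq c v h ⟩
      v * v * h * (384 * c)   ≤⟨ *-monoʳ-≤ (v * v * h) 384c≤V ⟩
      v * v * h * V           ∎)
      where
      eq : ∀ c v h → 192 * v * (2 * c * v * h) ≡ v * v * h * (384 * c)
      eq = solve-∀
    t₁ : v * v * δ * (4 * (4 * δ)) ≤ v * v * δ * (4 * (3 * h))
    t₁ = *-monoʳ-≤ (v * v * δ) (*-monoʳ-≤ 4 4δ≤3h)
    t₂ : h * (v * v) * (32 * y₀) ≤ h * (v * v) * (2 * δ)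
    t₂ = *-monoʳ-≤ (h * (v * v)) (≤-trans 32y₀≤h h≤2δ)
    t₃ : 32 * h * (2 * v + 1) * y ≤ h * (v * v) * (2 * δ)
    t₃ = begin
      32 * h * (2 * v + 1) * y    ≤⟨ *-mono-≤ (*-monoʳ-≤ (32 * h) 2v+1≤3v) y≤2y₁ ⟩
      32 * h * (3 * v) * (2 * y₁) ≡⟨ eq h v y₁ ⟩
      h * (192 * v * y₁)          ≤⟨ *-monoʳ-≤ h 192vy₁≤ ⟩
      h * (v * v * h)             ≤⟨ *-monoʳ-≤ h (*-monoʳ-≤ (v * v) h≤2δ) ⟩
      h * (v * v * (2 * δ))       ≡⟨ sym (*-assoc h (v * v) (2 * δ)) ⟩
      h * (v * v) * (2 * δ)       ∎
      where
      eq : ∀ h v y → 32 * h * (3 * v) * (2 * y) ≡ h * (192 * v * y)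
      eq = solve-∀
    main : 2 * h * (v * v) * y₀ + v * v * (δ * δ) + 2 * h * (2 * v + 1) * y ≤ h * (v * v) * δ
    -- In sixteenths of `h v² δ`, the three losses are allotted 12, 2 and 2.
    main = *-cancelˡ-≤ 16 (begin
      16 * (2 * h * (v * v) * y₀ + v * v * (δ * δ) + 2 * h * (2 * v + 1) * y)
        ≡⟨ eq h v y₀ δ y ⟩
      v * v * δ * (4 * (4 * δ)) + h * (v * v) * (32 * y₀) + 32 * h * (2 * v + 1) * y
        ≤⟨ +-mono-≤ (+-mono-≤ t₁ t₂) t₃ ⟩
      v * v * δ * (4 * (3 * h)) + h * (v * v) * (2 * δ) + h * (v * v) * (2 * δ)
        ≡⟨ eq′ h v δ ⟩
      16 * (h * (v * v) * δ) ∎)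
      where
      eq : ∀ h v y₀ δ y → 16 * (2 * h * (v * v) * y₀ + v * v * (δ * δ) + 2 * h * (2 * v + 1) * y)
         ≡ v * v * δ * (4 * (4 * δ)) + h * (v * v) * (32 * y₀) + 32 * h * (2 * v + 1) * y
      eq = solve-∀
      eq′ : ∀ h v δ → v * v * δ * (4 * (3 * h)) + h * (v * v) * (2 * δ) + h * (v * v) * (2 * δ) ≡ 16 * (h * (v * v) * δ)
      eq′ = solve-∀

  -- The linear term `v² δ/2` covers the penalty `v² δ²/(2h)`. Of the four parts `V² y²` of the
  -- second-order term, two pay for `v² y₀`, one for `4 V² y₀²` and one for `(2v+1) y`.
  stop-long : ∀ {y δ} → y₁ ≤ y → δ ≤ h → loss (y + δ) y + Z * ((suc v * suc v) * y) ≤ gain (y + δ) y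
  stop-long {y} {δ} y₁≤y δ≤h = core⇒stop y δ (begin
    2 * A * h * (v * v) * y₀ + 4 * (V * V) * (y₀ * y₀) + A * (v * v) * (δ * δ) + 2 * A * h * (2 * v + 1) * y
      ≡⟨ eq₁ A h v V y₀ y δ ⟩
    A * (v * v) * δ * δ + (2 * (A * h * (v * v) * y₀) + V * V * ((2 * y₀) * (2 * y₀)) + 2 * A * h * (2 * v + 1) * y)
      ≤⟨ +-mono-≤ (*-monoʳ-≤ (A * (v * v) * δ) δ≤h) (+-mono-≤ (+-mono-≤ (*-monoʳ-≤ 2 t₁) (*-monoʳ-≤ (V * V) (*-mono-≤ 2y₀≤y 2y₀≤y))) t₂) ⟩
    A * (v * v) * δ * h + (2 * (V * V * (y * y)) + V * V * (y * y) + V * V * (y * y))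
      ≡⟨ eq₂ A h v V y δ ⟩
    A * h * (v * v) * δ + V * V * ((2 * y) * (2 * y))
      ≤⟨ +-monoʳ-≤ (A * h * (v * v) * δ) (*-monoʳ-≤ (V * V) (*-mono-≤ (m≤m+n (2 * y) δ) (m≤m+n (2 * y) δ))) ⟩
    A * h * (v * v) * δ + V * V * ((2 * y + δ) * (2 * y + δ)) ∎)
    where
    open ≤-Reasoning
    eq₁ : ∀ A h v V y₀ y δ →
      2 * A * h * (v * v) * y₀ + 4 * (V * V) * (y₀ * y₀) + A * (v * v) * (δ * δ) + 2 * A * h * (2 * v + 1) * y
      ≡ A * (v * v) * δ * δ + (2 * (A * h * (v * v) * y₀) + V * V * ((2 * y₀) * (2 * y₀)) + 2 * A * h * (2 * v + 1) * y)
    eq₁ = solve-∀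
    eq₂ : ∀ A h v V y δ → A * (v * v) * δ * h + (2 * (V * V * (y * y)) + V * V * (y * y) + V * V * (y * y))
        ≡ A * h * (v * v) * δ + V * V * ((2 * y) * (2 * y))
    eq₂ = solve-∀
    2y₀≤y : 2 * y₀ ≤ y
    2y₀≤y = ≤-trans 2y₀≤y₁ y₁≤y
    yV≥ : 2 * c * v * h ≤ y * V
    yV≥ = ≤-trans (≤-reflexive (sym y₁V≡)) (*-monoˡ-≤ V y₁≤y)
    t₁ : A * h * (v * v) * y₀ ≤ V * V * (y * y)
    t₁ = begin
      A * h * (v * v) * y₀                ≡⟨ cong (λ z → z * h * (v * v) * y₀) A≡ ⟩
      64 * (c * c) * h * (v * v) * y₀     ≡⟨ eq c h v y₀ ⟩
      64 * c * (v * v) * h * (c * y₀)     ≡⟨ cong (64 * c * (v * v) * h *_) (sym h≡) ⟩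
      64 * c * (v * v) * h * h            ≡⟨ eq′ c v h ⟩
      16 * (2 * v * h) * (2 * c * v * h)  ≤⟨ *-monoˡ-≤ (2 * c * v * h) (*-monoˡ-≤ (2 * v * h) (≤-trans (m≤m+n 16 16) 32≤c)) ⟩
      c * (2 * v * h) * (2 * c * v * h)   ≡⟨ cong (_* (2 * c * v * h)) (eq″ c v h) ⟩
      2 * c * v * h * (2 * c * v * h)     ≤⟨ *-mono-≤ yV≥ yV≥ ⟩
      y * V * (y * V)                     ≡⟨ eq‴ y V ⟩
      V * V * (y * y)                     ∎
      where
      eq : ∀ c h v y → 64 * (c * c) * h * (v * v) * y ≡ 64 * c * (v * v) * h * (c * y)
      eq = solve-∀
      eq′ : ∀ c v h → 64 * c * (v * v) * h * h ≡ 16 * (2 * v * h) * (2 * c * v * h)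
      eq′ = solve-∀
      eq″ : ∀ c v h → c * (2 * v * h) ≡ 2 * c * v * h
      eq″ = solve-∀
      eq‴ : ∀ y V → y * V * (y * V) ≡ V * V * (y * y)
      eq‴ = solve-∀
    t₂ : 2 * A * h * (2 * v + 1) * y ≤ V * V * (y * y)
    t₂ = begin
      2 * A * h * (2 * v + 1) * y         ≤⟨ *-monoˡ-≤ y (*-monoʳ-≤ (2 * A * h) 2v+1≤3v) ⟩
      2 * A * h * (3 * v) * y             ≡⟨ cong (λ z → 2 * z * h * (3 * v) * y) A≡ ⟩
      2 * (64 * (c * c)) * h * (3 * v) * y ≡⟨ eq c h v y ⟩
      (192 * c) * (2 * c * v * h) * y     ≤⟨ *-monoˡ-≤ y (*-mono-≤ (≤-trans (*-monoˡ-≤ c (m≤m+n 192 192)) 384c≤V) yV≥) ⟩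
      V * (y * V) * y                     ≡⟨ eq′ V y ⟩
      V * V * (y * y)                     ∎
      where
      eq : ∀ c h v y → 2 * (64 * (c * c)) * h * (3 * v) * y ≡ (192 * c) * (2 * c * v * h) * y
      eq = solve-∀
      eq′ : ∀ V y → V * (y * V) * y ≡ V * V * (y * y)
      eq′ = solve-∀

  -- A game of at most 2 (scale y) units at rate v² costs less than walking y units.
  scale : ℕ → ℕ
  scale y = V * V * y / (16 * c * (v * v))

  scale-upper : ∀ y → 16 * c * (v * v) * scale y ≤ V * V * y
  scale-upper y = ≤-trans (≤-reflexive (*-comm (16 * c * (v * v)) (scale y))) (m/n*n≤m (V * V * y) (16 * c * (v * v)))

  -- The size of `y₀` is chosen for this: even the first inner game must be long enough for the
  -- strategy of the level below.
  scale-≥ : ∀ {y} → y₀ ≤ y → E ≤ scale y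
  scale-≥ {y} y₀≤y = begin
    E ≤⟨ ≤-trans (m≤n*m E (V * V * V) {{m*n≢0 (V * V) V {{m*n≢0 V V}}}}) (≤-reflexive (sym (m*n/n≡m (V * V * V * E) (16 * c * (v * v))))) ⟩
    V * V * V * E * (16 * c * (v * v)) / (16 * c * (v * v)) ≤⟨ /-monoˡ-≤ (16 * c * (v * v)) le ⟩
    scale y ∎
    where
    open ≤-Reasoning
    eq : ∀ V E k → V * V * V * E * k ≡ V * V * (k * (V * E))
    eq = solve-∀
    le : V * V * V * E * (16 * c * (v * v)) ≤ V * V * y
    le = ≤-trans (≤-reflexive (trans (eq V E (16 * c * (v * v))) (cong (V * V *_) (sym y₀≡)))) (*-monoʳ-≤ (V * V) y₀≤y)

  -- The quotient is at least 1, so rounding down loses at most a factor 2.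
  scale-lower : ∀ {y} → y₀ ≤ y → V * V * y ≤ 32 * c * (v * v) * scale y
  scale-lower {y} y₀≤y = begin
    V * V * y                         ≡⟨ m≡m%n+[m/n]*n (V * V * y) k ⟩
    V * V * y % k + scale y * k       ≤⟨ +-monoˡ-≤ (scale y * k) (<⇒≤ (m%n<n (V * V * y) k)) ⟩
    k + scale y * k                   ≤⟨ +-monoˡ-≤ (scale y * k) (m≤n*m k (scale y) {{>-nonZero (≤-trans 1≤E (scale-≥ y₀≤y))}}) ⟩
    scale y * k + scale y * k         ≡⟨ eq c v (scale y) ⟩
    32 * c * (v * v) * scale y        ∎
    where
    open ≤-Reasoning
    k = 16 * c * (v * v)
    eq : ∀ c v s → s * (16 * c * (v * v)) + s * (16 * c * (v * v)) ≡ 32 * c * (v * v) * s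
    eq = solve-∀

  module _ {y m} (m≤ : m ≤ 2 * scale y) where

    advance≤ : 8 * c * (v * v * m) ≤ V * V * y
    advance≤ = begin
      8 * c * (v * v * m)             ≤⟨ *-monoʳ-≤ (8 * c) (*-monoʳ-≤ (v * v) m≤) ⟩
      8 * c * (v * v * (2 * scale y)) ≡⟨ eq c v (scale y) ⟩
      16 * c * (v * v) * scale y      ≤⟨ scale-upper y ⟩
      V * V * y                       ∎
      where
      open ≤-Reasoning
      eq : ∀ c v s → 8 * c * (v * v * (2 * s)) ≡ 16 * c * (v * v) * s
      eq = solve-∀

    v²m≤V²y : v * v * m ≤ V * V * y
    v²m≤V²y = ≤-trans (m≤n*m (v * v * m) (8 * c) {{m*n≢0 8 c}}) advance≤

    m≤y : m ≤ y
    m≤y = *-cancelˡ-≤ (v * v) (≤-trans v²m≤V²y (*-monoˡ-≤ y (*-mono-≤ V≤v V≤v)))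

    4m≤h : y ≤ y₁ → 4 * m ≤ h
    4m≤h y≤y₁ = *-cancelˡ-≤ (2 * c * (v * v)) {{m*n≢0 (2 * c) (v * v) {{m*n≢0 2 c}}}} (begin
      2 * c * (v * v) * (4 * m)  ≡⟨ eq c v m ⟩
      8 * c * (v * v * m)        ≤⟨ advance≤ ⟩
      V * V * y                  ≤⟨ *-monoʳ-≤ (V * V) y≤y₁ ⟩
      V * V * y₁                 ≡⟨ trans (*-assoc V V y₁) (cong (V *_) (trans (*-comm V y₁) y₁V≡)) ⟩
      V * (2 * c * v * h)        ≤⟨ *-monoˡ-≤ (2 * c * v * h) V≤v ⟩
      v * (2 * c * v * h)        ≡⟨ eq′ c v h ⟩
      2 * c * (v * v) * h        ∎)
      where
      open ≤-Reasoning
      eq : ∀ c v m → 2 * c * (v * v) * (4 * m) ≡ 8 * c * (v * v * m)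
      eq = solve-∀
      eq′ : ∀ c v h → v * (2 * c * v * h) ≡ 2 * c * (v * v) * h
      eq′ = solve-∀

  sum≤ : ∀ {y δ} → y₀ ≤ y → 4 * δ ≤ 3 * h → 4 * (y + δ + y) ≤ (8 + 3 * c) * y
  sum≤ {y} {δ} y₀≤y 4δ≤ = begin
    4 * (y + δ + y)       ≡⟨ eq y δ ⟩
    8 * y + 4 * δ         ≤⟨ +-monoʳ-≤ (8 * y) 4δ≤ ⟩
    8 * y + 3 * h         ≡⟨ cong (λ z → 8 * y + 3 * z) h≡ ⟩
    8 * y + 3 * (c * y₀)  ≤⟨ +-monoʳ-≤ (8 * y) (*-monoʳ-≤ 3 (*-monoʳ-≤ c y₀≤y)) ⟩
    8 * y + 3 * (c * y)   ≡⟨ eq′ c y ⟩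
    (8 + 3 * c) * y       ∎
    where
    open ≤-Reasoning
    eq : ∀ y δ → 4 * (y + δ + y) ≡ 8 * y + 4 * δ
    eq = solve-∀
    eq′ : ∀ c y → 8 * y + 3 * (c * y) ≡ (8 + 3 * c) * y
    eq′ = solve-∀

  -- As `h = c y₀ ≤ c y`, the sum `L + R` is of order `c y`, and `V² y ≤ 32 c v² m`. The constant
  -- `A = 64 c²` absorbs the product of these two factors of order `c`.
  step-small : ∀ {y δ m} → y₀ ≤ y → 4 * δ ≤ 3 * h → scale y ≤ m → m ≤ 2 * scale y →
               V * V * (2 * (y + δ + y) + m) ≤ A * (v * v) * m
  step-small {y} {δ} {m} y₀≤y 4δ≤ ≤m m≤ = *-cancelˡ-≤ 2 (begin
    2 * (V * V * (2 * (y + δ + y) + m))      ≡⟨ eq₁ V (y + δ + y) m ⟩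
    V * V * (4 * (y + δ + y) + 2 * m)        ≤⟨ *-monoʳ-≤ (V * V) (+-mono-≤ (sum≤ {δ = δ} y₀≤y 4δ≤) (*-monoʳ-≤ 2 (m≤y m≤))) ⟩
    V * V * ((8 + 3 * c) * y + 2 * y)        ≡⟨ eq₂ V c y ⟩
    (10 + 3 * c) * (V * V * y)               ≤⟨ *-monoˡ-≤ (V * V * y) (+-monoˡ-≤ (3 * c) (≤-trans (m≤m+n 10 22) 32≤c)) ⟩
    (c + 3 * c) * (V * V * y)                ≤⟨ *-monoʳ-≤ (c + 3 * c) (scale-lower y₀≤y) ⟩
    (c + 3 * c) * (32 * c * (v * v) * scale y) ≤⟨ *-monoʳ-≤ (c + 3 * c) (*-monoʳ-≤ (32 * c * (v * v)) ≤m) ⟩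
    (c + 3 * c) * (32 * c * (v * v) * m)     ≡⟨ eq₃ c v m ⟩
    2 * (64 * (c * c) * (v * v) * m)         ≡⟨ cong (λ z → 2 * (z * (v * v) * m)) (sym A≡) ⟩
    2 * (A * (v * v) * m)                    ∎)
    where
    open ≤-Reasoning
    eq₁ : ∀ V s m → 2 * (V * V * (2 * s + m)) ≡ V * V * (4 * s + 2 * m)
    eq₁ = solve-∀
    eq₂ : ∀ V c y → V * V * ((8 + 3 * c) * y + 2 * y) ≡ (10 + 3 * c) * (V * V * y)
    eq₂ = solve-∀
    eq₃ : ∀ c v m → (c + 3 * c) * (32 * c * (v * v) * m) ≡ 2 * (64 * (c * c) * (v * v) * m)
    eq₃ = solve-∀

  -- Only the shorter branch counts as progress, while nodes were spent on both. This is the factor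
  -- `2 c` per level in the size of the tree.
  branches≤ : ∀ {y δ} → y₀ ≤ y → 4 * δ ≤ 3 * h → y + δ + y + 2 * scale y ≤ 2 * c * y
  branches≤ {y} {δ} y₀≤y 4δ≤ = *-cancelˡ-≤ 4 (begin
    4 * (y + δ + y + 2 * scale y)     ≡⟨ *-distribˡ-+ 4 (y + δ + y) (2 * scale y) ⟩
    4 * (y + δ + y) + 4 * (2 * scale y) ≤⟨ +-mono-≤ (sum≤ {δ = δ} y₀≤y 4δ≤) (*-monoʳ-≤ 4 (m≤y {y} ≤-refl)) ⟩
    (8 + 3 * c) * y + 4 * y           ≡⟨ eq c y ⟩
    (12 + 3 * c) * y                  ≤⟨ *-monoˡ-≤ y (+-monoˡ-≤ (3 * c) (≤-trans (≤-trans (m≤m+n 12 20) 32≤c) (m≤n*m c 5))) ⟩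
    (5 * c + 3 * c) * y               ≡⟨ eq′ c y ⟩
    4 * (2 * c * y)                   ∎)
    where
    open ≤-Reasoning
    eq : ∀ c y → (8 + 3 * c) * y + 4 * y ≡ (12 + 3 * c) * y
    eq = solve-∀
    eq′ : ∀ c y → (5 * c + 3 * c) * y ≡ 4 * (2 * c * y)
    eq′ = solve-∀

-- One level: rate v² is improved to (v+1)²

module Level {k : ℕ} (alg : Algorithm k) (S Δ Target : ℕ)
  (κ V v E : ℕ) (32≤κ : 32 ≤ κ) (384κ≤V : 384 * κ ≤ V) (V≤v : V ≤ v) (1≤E : 1 ≤ E) (C : ℕ) (1≤C : 1 ≤ C) where

  open Play alg S Δ Target
  open Strategies (V * V)
  open Numbers κ V v E 32≤κ 384κ≤V V≤v 1≤E

  U = V * V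

  instance
    U≢0 : NonZero U
    U≢0 = m*n≢0 V V

  swapCfg : ∀ {l r O} → Cfg (l ∷ r ∷ O) → Cfg (r ∷ l ∷ O)
  swapCfg c = cfg (tree c) (sched c) (All.head (All.tail (live c)) ∷ All.head (live c) ∷ All.tail (All.tail (live c)))
    (size≤ c) (depth≤ c)

  ∈-swap : ∀ {q l r : Pos} {O} → q ∈ l ∷ r ∷ O → q ∈ r ∷ l ∷ O
  ∈-swap (here eq)          = there (here eq)
  ∈-swap (there (here eq))  = here eq
  ∈-swap (there (there q∈)) = there (there q∈)

  module Round (sub : ∀ {e} → E ≤ e → Strategy (v * v) C e (2 * e))
    {p O} (c₀ : Cfg (p ∷ O)) (parked₀ : Parked c₀) (far₀ : Far p O)
    (deep : length p + U * (2 * κ * y₁) ≤ Δ)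
    (room : size (tree c₀) + 2 * κ * C * (U * (2 * κ * y₁)) ≤ S) where

    abstract
      ind : Pos → Pos → ℕ
      ind l q = if does (q ≟ₚ l) then 1 else 0

      ind-≡ : ∀ l → ind l l ≡ 1
      ind-≡ l with l ≟ₚ l
      ... | yes _ = refl
      ... | no ¬r = ⊥-elim (¬r refl)

      ind-≢ : ∀ {l q} → q ≢ l → ind l q ≡ 0
      ind-≢ {l} {q} q≢ with q ≟ₚ l
      ... | yes q≡ = ⊥-elim (q≢ q≡)
      ... | no _   = refl

      rest : Pos → Pos → Pos → ℕ
      rest l r q = if does (q ≟ₚ l) then 0 else if does (q ≟ₚ r) then 0 else Z * dist p q

      -- The charge scaled by `Z`: `Ψ` at either tip, the distance from `p` elsewhere. The
      -- indicators make its sum linear in `Ψ`, with the number of agents at the tips as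
      -- coefficient.
      φ : Pos → Pos → ℕ → Pos → ℕ
      φ l r Ψ q = (ind l q + ind r q) * Ψ + rest l r q

      φ-l : ∀ {l r} Ψ → l ≢ r → φ l r Ψ l ≡ Ψ
      φ-l {l} {r} Ψ l≢r with l ≟ₚ l | l ≟ₚ r
      ... | no ¬l | _       = ⊥-elim (¬l refl)
      ... | _     | yes l≡r = ⊥-elim (l≢r l≡r)
      ... | yes _ | no _    = trans (+-identityʳ _) (+-identityʳ Ψ)

      φ-r : ∀ {l r} Ψ → l ≢ r → φ l r Ψ r ≡ Ψ
      φ-r {l} {r} Ψ l≢r with r ≟ₚ l | r ≟ₚ r
      ... | yes r≡l | _     = ⊥-elim (l≢r (sym r≡l))
      ... | no _    | no ¬r = ⊥-elim (¬r refl)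
      ... | no _    | yes _ = trans (+-identityʳ _) (+-identityʳ Ψ)

      φ-out : ∀ {l r q} Ψ → q ≢ l → q ≢ r → φ l r Ψ q ≡ Z * dist p q
      φ-out {l} {r} {q} Ψ q≢l q≢r with q ≟ₚ l | q ≟ₚ r
      ... | yes q≡l | _       = ⊥-elim (q≢l q≡l)
      ... | no _    | yes q≡r = ⊥-elim (q≢r q≡r)
      ... | no _    | no _    = refl

      φ-swap : ∀ l r Ψ q → φ r l Ψ q ≡ φ l r Ψ q
      φ-swap l r Ψ q with q ≟ₚ l | q ≟ₚ r
      ... | yes _ | yes _ = refl
      ... | yes _ | no _  = refl
      ... | no _  | yes _ = refl
      ... | no _  | no _  = refl

      sum-φ : ∀ l r Ψ (f : Fin k → Pos) →
              sum (λ i → φ l r Ψ (f i)) ≡ (sum (λ i → ind l (f i)) + sum (λ i → ind r (f i))) * Ψ + sum (λ i → rest l r (f i))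
      sum-φ l r Ψ f = trans (∑-distrib-+ (λ i → (ind l (f i) + ind r (f i)) * Ψ) (λ i → rest l r (f i)))
        (cong (_+ sum (λ i → rest l r (f i)))
          (trans (sym (*-distribʳ-sum Ψ (λ i → ind l (f i) + ind r (f i))))
            (cong (_* Ψ) (∑-distrib-+ (λ i → ind l (f i)) (λ i → ind r (f i))))))

    potential : ℕ → ℕ → ℕ
    potential L R = gain L R ∸ loss L R

    record Two (l r : Pos) (L R : ℕ) : Set where
      field
        c       : Cfg (l ∷ r ∷ O)
        parked  : Parked c
        {a b}   : ℕ
        {x y}   : List ℕ
        a≢b     : a ≢ b
        l≡      : l ≡ x ++ a ∷ p
        r≡      : r ≡ y ++ b ∷ p
        |l|     : suc (length x) ≡ U * L
        |r|     : suc (length y) ≡ U * R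
        unmoved : ∀ i → at c₀ i ≢ p → at c i ≡ at c₀ i
        growth  : size (tree c) ≤ size (tree c₀) + C * (U * (L + R))
        y₀≤L    : y₀ ≤ L
        y₀≤R    : y₀ ≤ R
        balance : Balanced L R
        -- Bounds the smaller length without fixing which branch it is.
        short   : L ≤ 2 * y₁ ⊎ R ≤ 2 * y₁
        cost    : Z * moves c₀ + sum (λ i → φ l r (potential L R) (at c i)) ≤ Z * moves c + Z * sum (λ i → dist p (at c₀ i))

      x⁺ : List ℕ
      x⁺ = x ++ a ∷ []
      l≡⁺ : l ≡ x⁺ ++ p
      l≡⁺ = trans l≡ (sym (++-assoc x (a ∷ []) p))
      |x⁺| : length x⁺ ≡ U * L
      |x⁺| = trans (length-++ x) (trans (+-comm (length x) 1) |l|)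
      l-far : Far l O
      l-far = subst (λ q → Far q O) (sym l≡⁺) (Far-++ x⁺ far₀)
      l∤r : ¬ Below l r
      l∤r = subst₂ (λ l r → ¬ Below l r) (sym l≡) (sym r≡) (fork-¬Below p x y a≢b)
      l≢r : l ≢ r
      l≢r refl = l∤r ([] , refl)
      dist-lr : dist l r ≡ U * L + U * R
      dist-lr = trans (cong₂ dist l≡ r≡) (trans (dist-fork p x y a≢b) (cong₂ _+_ |l| |r|))
      dist-l : ∀ {q} → q ∈ O → dist l q ≡ U * L + dist p q
      dist-l {q} q∈ = trans (cong (λ z → dist z q) l≡⁺)
        (trans (dist-escape p x⁺ q (All.lookup far₀ q∈)) (cong (_+ dist p q) |x⁺|))
      length-l : length l ≡ U * L + length p
      length-l = trans (cong length l≡⁺) (trans (length-++ x⁺) (cong (_+ length p) |x⁺|))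
      count-l count-r : ℕ
      count-l = sum (λ i → ind l (at c i))
      count-r = sum (λ i → ind r (at c i))

    swapTwo : ∀ {l r L R} → Two l r L R → Two r l R L
    swapTwo {l} {r} {L} {R} T = record
      { c = swapCfg c ; parked = λ i → ∈-swap (parked i) ; a≢b = a≢b ∘ sym ; l≡ = r≡ ; r≡ = l≡ ; |l| = |r| ; |r| = |l|
      ; unmoved = unmoved ; growth = subst (λ n → size (tree c) ≤ size (tree c₀) + C * (U * n)) (+-comm L R) growth
      ; y₀≤L = y₀≤R ; y₀≤R = y₀≤L ; balance = swap balance ; short = Sum.swap short
      ; cost = subst (λ n → Z * moves c₀ + n ≤ Z * moves c + Z * sum (λ i → dist p (at c₀ i)))
                 (sum-cong-≗ (λ i → trans (sym (φ-swap l r (potential L R) (at c i)))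
                   (cong (λ Ψ → φ r l Ψ (at c i)) (cong₂ _∸_ (gain-comm L R) (loss-comm L R))))) cost }
      where open Two T

    loss≤gain : ∀ {L R} → y₀ ≤ L → y₀ ≤ R → Balanced L R → loss L R ≤ gain L R
    loss≤gain {L} {R} y₀≤L y₀≤R (4L≤ , 4R≤) with ≤-total R L
    ... | inj₁ R≤L = loss≤gain-sorted y₀≤R R≤L (balanced⇒≤ 4L≤)
    ... | inj₂ L≤R = subst₂ _≤_ (loss-comm R L) (gain-comm R L) (loss≤gain-sorted y₀≤L L≤R (balanced⇒≤ 4R≤))

    potential-step : ∀ {a x L R m} → loss L R ≤ gain L R → loss (L + m) R ≤ gain (L + m) R →
      a * gain (L + m) R + a * loss L R ≤ a * gain L R + a * loss (L + m) R + x →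
      a * potential (L + m) R ≤ a * potential L R + x
    potential-step {a} {x} {L} {R} {m} le le′ bound = +-cancelʳ-≤ (a * loss (L + m) R + a * loss L R) _ _ (begin
      a * Ψ′ + (a * loss (L + m) R + a * loss L R)     ≡⟨ eq₁ a Ψ′ (loss (L + m) R) (loss L R) ⟩
      a * (Ψ′ + loss (L + m) R) + a * loss L R         ≡⟨ cong (λ z → a * z + a * loss L R) (m∸n+n≡m le′) ⟩
      a * gain (L + m) R + a * loss L R                ≤⟨ bound ⟩
      a * gain L R + a * loss (L + m) R + x            ≡⟨ cong (λ z → a * z + a * loss (L + m) R + x) (sym (m∸n+n≡m le)) ⟩
      a * (Ψ + loss L R) + a * loss (L + m) R + x      ≡⟨ eq₂ a Ψ (loss L R) (loss (L + m) R) x ⟩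
      a * Ψ + x + (a * loss (L + m) R + a * loss L R)  ∎)
      where
      open ≤-Reasoning
      Ψ  = potential L R
      Ψ′ = potential (L + m) R
      eq₁ : ∀ a Ψ m n → a * Ψ + (a * m + a * n) ≡ a * (Ψ + m) + a * n
      eq₁ = solve-∀
      eq₂ : ∀ a Ψ n m x → a * (Ψ + n) + a * m + x ≡ a * Ψ + x + (a * m + a * n)
      eq₂ = solve-∀

    -- For the inner game on `l`, the other tip `r` is just one more leaf where agents may park.
    extend : ∀ {l r L R e} (T : Two l r L R) → let open Two T in
      E ≤ e → L + R + 2 * e ≤ 2 * κ * y₁ →
      (count-l + count-r) * h + 2 * ((count-l + count-r) * R) ≤ 2 * ((count-l + count-r) * L) + 2 * (h * count-l) →
      (∀ {m} → e ≤ m → m ≤ 2 * e → v * v * m ≤ U * L × V * V * (2 * (L + R) + m) ≤ A * (v * v) * m ×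
                                   Balanced (L + m) R × (L + m ≤ 2 * y₁ ⊎ R ≤ 2 * y₁)) →
      Win ⊎ (∃[ m ] ∃[ l′ ] (e ≤ m × Two l′ r (L + m) R))
    extend {l} {r} {L} {R} {e} T E≤e fits choice next with sub E≤e (Two.c T) (Two.parked T) (l∤r ∷ l-far) deep′ room′
      where
      open Two T
      open ≤-Reasoning
      deep′ : length l + U * (2 * e) ≤ Δ
      deep′ = begin
        length l + U * (2 * e)              ≡⟨ cong (_+ U * (2 * e)) length-l ⟩
        U * L + length p + U * (2 * e)      ≡⟨ eq U L (length p) e ⟩
        length p + U * (L + 2 * e)          ≤⟨ +-monoʳ-≤ (length p) (*-monoʳ-≤ U (≤-trans (+-monoˡ-≤ (2 * e) (m≤m+n L R)) fits)) ⟩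
        length p + U * (2 * κ * y₁)         ≤⟨ deep ⟩
        Δ                                   ∎
        where
        eq : ∀ U L l e → U * L + l + U * (2 * e) ≡ l + U * (L + 2 * e)
        eq = solve-∀
      room′ : size (tree c) + C * (U * (2 * e)) ≤ S
      room′ = begin
        size (tree c) + C * (U * (2 * e))                          ≤⟨ +-monoˡ-≤ _ growth ⟩
        size (tree c₀) + C * (U * (L + R)) + C * (U * (2 * e))     ≡⟨ eq (size (tree c₀)) C U (L + R) e ⟩
        size (tree c₀) + C * (U * (L + R + 2 * e))                 ≤⟨ +-monoʳ-≤ (size (tree c₀)) (*-mono-≤ (m≤n*m C (2 * κ) {{m*n≢0 2 κ}}) (*-monoʳ-≤ U fits)) ⟩
        size (tree c₀) + 2 * κ * C * (U * (2 * κ * y₁))            ≤⟨ room ⟩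
        S                                                          ∎
        where
        eq : ∀ s C U n e → s + C * (U * n) + C * (U * (2 * e)) ≡ s + C * (U * (n + 2 * e))
        eq = solve-∀
    ... | inj₁ win = inj₁ win
    ... | inj₂ (m , e≤m , m≤2e , B) with next e≤m m≤2e
    ... | v²m≤ , small , balance′ , short′ = inj₂ (m , B.p′ , e≤m , record
      { c = B.cfg′ ; parked = B.parked ; a≢b = a≢b
      ; l≡ = trans B.p′≡ (trans (cong (B.w ++_) l≡) (sym (++-assoc B.w x _))) ; r≡ = r≡
      ; |l| = trans (cong suc (trans (length-++ B.w) (cong (_+ length x) B.length≡)))
                (trans (sym (+-suc (U * m) (length x))) (trans (cong (U * m +_) |l|)
                  (trans (+-comm (U * m) _) (sym (*-distribˡ-+ U L m)))))
      ; |r| = |r|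
      ; unmoved = λ i i≢ → trans (B.unmoved i (λ eq → Far-≢ l-far (∈-tail (parked₀ i) i≢) (trans (sym (unmoved i i≢)) eq))) (unmoved i i≢)
      ; growth = ≤-trans B.growth (≤-trans (+-monoˡ-≤ _ growth) (≤-reflexive (growth-eq (size (tree c₀)) C U L R m)))
      ; y₀≤L = ≤-trans y₀≤L (m≤m+n L m) ; y₀≤R = y₀≤R ; balance = balance′ ; short = short′ ; cost = cost′ })
      where
      open Two T
      module B = Advance B
      growth-eq : ∀ s C U L R m → s + C * (U * (L + R)) + C * (U * m) ≡ s + C * (U * (L + m + R))
      growth-eq = solve-∀
      l′ = B.p′
      Ψ  = potential L R
      Ψ′ = potential (L + m) R
      X = v * v * m
      l′-far : ∀ {q} → q ∈ O → q ≢ l′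
      l′-far q∈ = far-≢ {w = B.w} l-far B.p′≡ q∈
      l′≢r : l′ ≢ r
      l′≢r eq = l∤r (B.w , trans (sym eq) B.p′≡)
      r-far : ∀ {q} → q ∈ O → q ≢ r
      r-far q∈ = Far-≢ (Two.l-far (swapTwo T)) q∈
      -- `Ψ′` stands on both sides: the passage from `Ψ` to `Ψ′` is not paid agent by agent but only
      -- in the sum, by `charge`, out of the `X = v² m` collected from each agent at `l`.
      Pointwise : Fin k → Set
      Pointwise i = φ l′ r Ψ′ (at B.cfg′ i) + (Z * dist l (at c i) + Z * X * ind l (at c i)) ≤
                    φ l r Ψ′ (at c i) + Z * wt l′ X l (at B.cfg′ i)
      pointwise-≢ : ∀ i → at c i ≢ l → Pointwise i
      pointwise-≢ i i≢ rewrite B.unmoved i i≢ | ind-≢ i≢ | *-zeroʳ (Z * X) | +-identityʳ (Z * dist l (at c i)) = case parked i of λ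
        { (here i≡)         → ⊥-elim (i≢ i≡)
        ; (there (here i≡)) → ≤-reflexive (cong₂ _+_
            (trans (cong (φ l′ r Ψ′) i≡) (trans (φ-r Ψ′ l′≢r) (sym (trans (cong (φ l r Ψ′) i≡) (φ-r Ψ′ l≢r)))))
            (cong (Z *_) (sym (wt-≢ X l (λ eq → l′≢r (trans (sym eq) i≡))))))
        ; (there (there i∈)) → ≤-reflexive (cong₂ _+_
            (trans (φ-out Ψ′ (l′-far i∈) (r-far i∈)) (sym (φ-out Ψ′ i≢ (r-far i∈))))
            (cong (Z *_) (sym (wt-≢ X l (l′-far i∈))))) }
      pointwise-≡ : ∀ i → at c i ≡ l → Pointwise i
      pointwise-≡ i i≡ rewrite i≡ | ind-≡ l | *-identityʳ (Z * X) | dist-refl l | *-zeroʳ Z | φ-l {l} {r} Ψ′ l≢r = case B.parked i of λ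
        { (here i≡′)         → ≤-reflexive (cong₂ _+_ (trans (cong (φ l′ r Ψ′) i≡′) (φ-l Ψ′ l′≢r))
            (cong (Z *_) (sym (trans (cong (wt l′ X l) i≡′) (wt-≡ l′ X l)))))
        -- Crossing over to `r` takes at least `U L ≥ v² m` moves, no less than the price of
        -- staying.
        ; (there (here i≡′)) → +-mono-≤ (≤-reflexive (trans (cong (φ l′ r Ψ′) i≡′) (φ-r Ψ′ l′≢r)))
            (*-monoʳ-≤ Z (≤-trans v²m≤ (≤-trans (m≤m+n _ (U * R))
              (≤-reflexive (sym (trans (cong (wt l′ X l) i≡′) (trans (wt-≢ X l (l′≢r ∘ sym)) dist-lr)))))))
        ; (there (there i∈)) → escaped (at B.cfg′ i) i∈ }
        where
        escaped : ∀ q → q ∈ O → φ l′ r Ψ′ q + Z * X ≤ Ψ′ + Z * wt l′ X l q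
        escaped q q∈ = begin
          φ l′ r Ψ′ q + Z * X             ≡⟨ cong (_+ Z * X) (φ-out Ψ′ (l′-far q∈) (r-far q∈)) ⟩
          Z * dist p q + Z * X            ≡⟨ sym (*-distribˡ-+ Z _ X) ⟩
          Z * (dist p q + X)              ≤⟨ *-monoʳ-≤ Z (+-monoʳ-≤ (dist p q) v²m≤) ⟩
          Z * (dist p q + U * L)          ≡⟨ cong (Z *_) (+-comm (dist p q) (U * L)) ⟩
          Z * (U * L + dist p q)          ≡⟨ cong (Z *_) (sym (trans (wt-≢ X l (l′-far q∈)) (dist-l q∈))) ⟩
          Z * wt l′ X l q                 ≤⟨ m≤n+m _ Ψ′ ⟩
          Ψ′ + Z * wt l′ X l q            ∎
          where open ≤-Reasoning
      pointwise : ∀ i → Pointwise i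
      pointwise i = case at c i ≟ₚ l of λ { (yes i≡) → pointwise-≡ i i≡ ; (no i≢) → pointwise-≢ i i≢ }
      a⁺ = count-l + count-r
      charge : sum (λ i → φ l r Ψ′ (at c i)) ≤ sum (λ i → φ l r Ψ (at c i)) + Z * X * count-l
      charge = begin
        sum (λ i → φ l r Ψ′ (at c i))     ≡⟨ sum-φ l r Ψ′ (at c) ⟩
        a⁺ * Ψ′ + ρ                       ≤⟨ +-monoˡ-≤ ρ (potential-step {a⁺} {L = L} {R} {m} (loss≤gain y₀≤L y₀≤R balance)
                                               (loss≤gain (≤-trans y₀≤L (m≤m+n L m)) y₀≤R balance′)
                                               (step-bound {a⁺} {count-l} {L} {R} {m} small choice)) ⟩
        a⁺ * Ψ + Z * (X * count-l) + ρ    ≡⟨ eq (a⁺ * Ψ) Z X count-l ρ ⟩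
        a⁺ * Ψ + ρ + Z * X * count-l      ≡⟨ cong (_+ Z * X * count-l) (sym (sum-φ l r Ψ (at c))) ⟩
        sum (λ i → φ l r Ψ (at c i)) + Z * X * count-l ∎
        where
        open ≤-Reasoning
        ρ = sum (λ i → rest l r (at c i))
        eq : ∀ a Z X n ρ → a + Z * (X * n) + ρ ≡ a + ρ + Z * X * n
        eq = solve-∀
      Φ Φ′ D W D₀ : ℕ
      Φ  = sum (λ i → φ l r Ψ (at c i))
      Φ′ = sum (λ i → φ l′ r Ψ′ (at B.cfg′ i))
      D  = sum (λ i → dist l (at c i))
      W  = sum (λ i → wt l′ X l (at B.cfg′ i))
      D₀ = sum (λ i → dist p (at c₀ i))
      summed : Φ′ + Z * D ≤ Φ + Z * W
      summed = +-cancelʳ-≤ (Z * X * count-l) _ _ (begin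
        Φ′ + Z * D + Z * X * count-l      ≡⟨ +-assoc Φ′ _ _ ⟩
        Φ′ + (Z * D + Z * X * count-l)    ≡⟨ cong (Φ′ +_) (cong₂ _+_ (*-distribˡ-sum Z (λ i → dist l (at c i))) (*-distribˡ-sum (Z * X) (λ i → ind l (at c i)))) ⟩
        Φ′ + (sum (λ i → Z * dist l (at c i)) + sum (λ i → Z * X * ind l (at c i)))
          ≡⟨ cong (Φ′ +_) (sym (∑-distrib-+ (λ i → Z * dist l (at c i)) (λ i → Z * X * ind l (at c i)))) ⟩
        Φ′ + sum (λ i → Z * dist l (at c i) + Z * X * ind l (at c i))
          ≡⟨ sym (∑-distrib-+ (λ i → φ l′ r Ψ′ (at B.cfg′ i)) (λ i → Z * dist l (at c i) + Z * X * ind l (at c i))) ⟩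
        sum (λ i → φ l′ r Ψ′ (at B.cfg′ i) + (Z * dist l (at c i) + Z * X * ind l (at c i)))
          ≤⟨ sum-mono pointwise ⟩
        sum (λ i → φ l r Ψ′ (at c i) + Z * wt l′ X l (at B.cfg′ i))
          ≡⟨ ∑-distrib-+ (λ i → φ l r Ψ′ (at c i)) (λ i → Z * wt l′ X l (at B.cfg′ i)) ⟩
        sum (λ i → φ l r Ψ′ (at c i)) + sum (λ i → Z * wt l′ X l (at B.cfg′ i))
          ≡⟨ cong (sum (λ i → φ l r Ψ′ (at c i)) +_) (sym (*-distribˡ-sum Z (λ i → wt l′ X l (at B.cfg′ i)))) ⟩
        sum (λ i → φ l r Ψ′ (at c i)) + Z * W ≤⟨ +-monoˡ-≤ (Z * W) charge ⟩
        Φ + Z * X * count-l + Z * W       ≡⟨ eq Φ (Z * X * count-l) (Z * W) ⟩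
        Φ + Z * W + Z * X * count-l       ∎)
        where
        open ≤-Reasoning
        eq : ∀ a b c → a + b + c ≡ a + c + b
        eq = solve-∀
      cost′ : Z * moves c₀ + Φ′ ≤ Z * moves B.cfg′ + Z * D₀
      cost′ = +-cancelʳ-≤ (Z * D) _ _ (begin
        Z * moves c₀ + Φ′ + Z * D           ≡⟨ +-assoc (Z * moves c₀) Φ′ _ ⟩
        Z * moves c₀ + (Φ′ + Z * D)         ≤⟨ +-monoʳ-≤ (Z * moves c₀) summed ⟩
        Z * moves c₀ + (Φ + Z * W)          ≡⟨ sym (+-assoc (Z * moves c₀) Φ _) ⟩
        Z * moves c₀ + Φ + Z * W            ≤⟨ +-monoˡ-≤ (Z * W) cost ⟩
        Z * moves c + Z * D₀ + Z * W        ≡⟨ eq₁ Z (moves c) D₀ W ⟩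
        Z * (moves c + W) + Z * D₀          ≤⟨ +-monoˡ-≤ (Z * D₀) (*-monoʳ-≤ Z B.cost) ⟩
        Z * (moves B.cfg′ + D) + Z * D₀     ≡⟨ eq₂ Z (moves B.cfg′) D D₀ ⟩
        Z * moves B.cfg′ + Z * D₀ + Z * D   ∎)
        where
        open ≤-Reasoning
        eq₁ : ∀ Z m d w → Z * m + Z * d + Z * w ≡ Z * (m + w) + Z * d
        eq₁ = solve-∀
        eq₂ : ∀ Z m d e → Z * (m + d) + Z * e ≡ Z * m + Z * e + Z * d
        eq₂ = solve-∀

    -- `l` is dropped from the live leaves, so its agents are activated until they park on `r` or in
    -- `O`. For those that reach `r` the walk is given away: `Ψ` alone is at least `Z (v+1)² R`.
    finish : ∀ {l r L R} → Two l r L R → loss L R + Z * (suc v * suc v * R) ≤ gain L R → L + R ≤ 2 * κ * R →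
             Win ⊎ Advance (suc v * suc v) (2 * κ * C) R c₀
    finish {l} {r} {L} {R} T stop L+R≤ with drive (cfg (tree (Two.c T)) (sched (Two.c T)) (All.tail (live (Two.c T))) (size≤ (Two.c T)) (depth≤ (Two.c T)))
    ... | inj₁ win = inj₁ win
    ... | inj₂ (driven c′ tree≡ parked′ unmoved′ cost′) = inj₂ (record
      { p′ = r ; w = S.x⁺ ; p′≡ = S.l≡⁺ ; length≡ = S.|x⁺| ; cfg′ = c′ ; parked = parked′
      ; unmoved = λ i i≢ → trans (unmoved′ i (there (subst (_∈ O) (sym (unmoved i i≢)) (∈-tail (parked₀ i) i≢)))) (unmoved i i≢)
      ; growth = growth′ ; cost = *-cancelˡ-≤ Z cost″ })
      where
      open Two T
      module S = Two (swapTwo T)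
      Ψ = potential L R
      X = suc v * suc v * R
      ZX≤Ψ : Z * X ≤ Ψ
      ZX≤Ψ = m+n≤o⇒n≤o∸m stop
        where
        m+n≤o⇒n≤o∸m : ∀ {m n o} → m + n ≤ o → n ≤ o ∸ m
        m+n≤o⇒n≤o∸m {m} {n} {o} le = ≤-trans (≤-reflexive (sym (m+n∸m≡n m n))) (∸-monoˡ-≤ m le)
      growth′ : size (tree c′) ≤ size (tree c₀) + 2 * κ * C * (U * R)
      growth′ = begin
        size (tree c′)                             ≡⟨ cong size tree≡ ⟩
        size (tree c)                              ≤⟨ growth ⟩
        size (tree c₀) + C * (U * (L + R))         ≤⟨ +-monoʳ-≤ (size (tree c₀)) (*-monoʳ-≤ C (*-monoʳ-≤ U L+R≤)) ⟩
        size (tree c₀) + C * (U * (2 * κ * R))     ≡⟨ eq (size (tree c₀)) C U κ R ⟩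
        size (tree c₀) + 2 * κ * C * (U * R)       ∎
        where
        open ≤-Reasoning
        eq : ∀ s C U κ R → s + C * (U * (2 * κ * R)) ≡ s + 2 * κ * C * (U * R)
        eq = solve-∀
      Bound : Fin k → Set
      Bound i = Z * wt r X p (at c′ i) ≤ φ l r Ψ (at c i) + Z * dist (at c i) (at c′ i)
      still : ∀ i → at c i ∈ r ∷ O → at c i ≢ r → Bound i
      still i i∈ i≢r rewrite unmoved′ i i∈ | wt-≢ X p i≢r | φ-out {l} Ψ (Far-≢ l-far (∈-tail i∈ i≢r)) i≢r = m≤m+n _ _
      bound-r : ∀ i → at c i ≡ r → Bound i
      bound-r i i≡ rewrite unmoved′ i (here i≡) | i≡ | wt-≡ r X p | φ-r {l} Ψ l≢r = ≤-trans ZX≤Ψ (m≤m+n Ψ _)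
      bound-l : ∀ i → at c i ≡ l → Bound i
      bound-l i i≡ rewrite i≡ | φ-l {r = r} Ψ l≢r = case parked′ i of λ
        { (here i≡′) → ≤-trans (≤-reflexive (cong (Z *_) (trans (cong (wt r X p) i≡′) (wt-≡ r X p)))) (≤-trans ZX≤Ψ (m≤m+n Ψ _))
        ; (there i∈) → ≤-trans (≤-reflexive (cong (Z *_) (wt-≢ X p (Far-≢ S.l-far i∈))))
            (≤-trans (*-monoʳ-≤ Z (≤-trans (m≤n+m _ (U * L)) (≤-reflexive (sym (dist-l i∈))))) (m≤n+m _ Ψ)) }
      bound : ∀ i → Bound i
      bound i = case parked i of λ
        { (here i≡)          → bound-l i i≡
        ; (there (here i≡))  → bound-r i i≡
        ; (there (there i∈)) → still i (there i∈) (Far-≢ S.l-far i∈) }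
      cost″ : Z * (moves c₀ + sum (λ i → wt r X p (at c′ i))) ≤ Z * (moves c′ + sum (λ i → dist p (at c₀ i)))
      cost″ = begin
        Z * (moves c₀ + W)                  ≡⟨ trans (*-distribˡ-+ Z _ W) (cong (Z * moves c₀ +_) (*-distribˡ-sum Z (λ i → wt r X p (at c′ i)))) ⟩
        Z * moves c₀ + sum (λ i → Z * wt r X p (at c′ i)) ≤⟨ +-monoʳ-≤ (Z * moves c₀) (sum-mono bound) ⟩
        Z * moves c₀ + sum (λ i → φ l r Ψ (at c i) + Z * dist (at c i) (at c′ i))
          ≡⟨ cong (Z * moves c₀ +_) (trans (∑-distrib-+ (λ i → φ l r Ψ (at c i)) (λ i → Z * dist (at c i) (at c′ i)))
               (cong (Φ +_) (sym (*-distribˡ-sum Z (λ i → dist (at c i) (at c′ i)))))) ⟩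
        Z * moves c₀ + (Φ + Z * D)          ≡⟨ sym (+-assoc (Z * moves c₀) Φ _) ⟩
        Z * moves c₀ + Φ + Z * D            ≤⟨ +-monoˡ-≤ (Z * D) cost ⟩
        Z * moves c + Z * D₀ + Z * D        ≡⟨ eq Z (moves c) D₀ D ⟩
        Z * (moves c + D + D₀)              ≤⟨ *-monoʳ-≤ Z (+-monoˡ-≤ D₀ cost′) ⟩
        Z * (moves c′ + D₀)                 ∎
        where
        open ≤-Reasoning
        W  = sum (λ i → wt r X p (at c′ i))
        Φ  = sum (λ i → φ l r Ψ (at c i))
        D  = sum (λ i → dist (at c i) (at c′ i))
        D₀ = sum (λ i → dist p (at c₀ i))
        eq : ∀ Z m d e → Z * m + Z * d + Z * e ≡ Z * (m + e + d)
        eq = solve-∀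

    Outcome : Set
    Outcome = Win ⊎ (∃[ m ] (1 ≤ m × m ≤ 2 * κ * y₁ × Advance (suc v * suc v) (2 * κ * C) m c₀))

    done : ∀ {l r L R} → Two l r L R → R ≤ 2 * y₁ → loss L R + Z * (suc v * suc v * R) ≤ gain L R → L + R ≤ 2 * κ * R → Outcome
    done {R = R} T R≤ stop L+R≤ with finish T stop L+R≤
    ... | inj₁ win = inj₁ win
    ... | inj₂ A   = inj₂ (R , ≤-trans 1≤y₀ (Two.y₀≤R T) , ≤-trans R≤ (*-monoˡ-≤ y₁ (*-monoʳ-≤ 2 1≤c)) , A)

    mutual
      loop : ∀ fuel {l r L R} → Two l r L R → 4 * y₁ + h < L + R + fuel → Outcome
      loop fuel {L = L} {R} T enough with ≤-total R L
      ... | inj₁ R≤L = sorted fuel T R≤L enough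
      ... | inj₂ L≤R = sorted fuel (swapTwo T) L≤R (subst (λ n → 4 * y₁ + h < n + fuel) (+-comm L R) enough)

      sorted : ∀ fuel {l r L R} → Two l r L R → R ≤ L → 4 * y₁ + h < L + R + fuel → Outcome
      sorted fuel {l} {r} {L} {R} T R≤L enough with m≤n⇒∃[o]m+o≡n R≤L
      ... | δ , refl = go fuel enough
        where
        open Two T
        R≤2y₁ : R ≤ 2 * y₁
        R≤2y₁ = case short of λ { (inj₁ L≤) → ≤-trans R≤L L≤ ; (inj₂ R≤) → R≤ }
        4δ≤3h : 4 * δ ≤ 3 * h
        4δ≤3h = +-cancelˡ-≤ (4 * R) (4 * δ) (3 * h) (≤-trans (≤-reflexive (sym (*-distribˡ-+ 4 R δ))) (proj₁ balance))
        wide : R + δ + R ≤ 2 * κ * R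
        wide = ≤-trans (m≤m+n _ _) (branches≤ {R} {δ} y₀≤R 4δ≤3h)
        go : ∀ fuel → 4 * y₁ + h < R + δ + R + fuel → Outcome
        -- Fuel cannot run out: the invariants keep `L + R ≤ 4 y₁ + h`, and each extension adds at
        -- least one unit.
        go zero enough = ⊥-elim (<⇒≱ enough (begin
          R + δ + R + 0        ≡⟨ eq R δ ⟩
          2 * R + δ            ≤⟨ +-mono-≤ (*-monoʳ-≤ 2 R≤2y₁) (+-cancelˡ-≤ R δ h (balanced⇒≤ (proj₁ balance))) ⟩
          2 * (2 * y₁) + h     ≡⟨ cong (_+ h) (sym (*-assoc 2 2 y₁)) ⟩
          4 * y₁ + h           ∎))
          where
          open ≤-Reasoning
          eq : ∀ R δ → R + δ + R + 0 ≡ 2 * R + δ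
          eq = solve-∀
        go (suc fuel) enough with h ≤? 2 * δ
        ... | yes h≤2δ = done T R≤2y₁ (stop-unbalanced y₀≤R R≤2y₁ h≤2δ 4δ≤3h) wide
        ... | no  h≰2δ with y₁ ≤? R
        ...   | yes y₁≤R = done T R≤2y₁ (stop-long y₁≤R (+-cancelˡ-≤ R δ h (balanced⇒≤ (proj₁ balance)))) wide
        ...   | no  y₁≰R with (count-l + count-r) * h + 2 * ((count-l + count-r) * R) ≤? 2 * ((count-l + count-r) * (R + δ)) + 2 * (h * count-l)
        ...     | yes choice = longer (extend T (scale-≥ y₀≤R) fits choice next)
          where
          R≤y₁ : R ≤ y₁
          R≤y₁ = <⇒≤ (≰⇒> y₁≰R)
          fits : R + δ + R + 2 * scale R ≤ 2 * κ * y₁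
          fits = ≤-trans (branches≤ {R} {δ} y₀≤R 4δ≤3h) (*-monoʳ-≤ (2 * κ) R≤y₁)
          next : ∀ {m} → scale R ≤ m → m ≤ 2 * scale R →
            v * v * m ≤ U * (R + δ) × V * V * (2 * (R + δ + R) + m) ≤ A * (v * v) * m × Balanced (R + δ + m) R × (R + δ + m ≤ 2 * y₁ ⊎ R ≤ 2 * y₁)
          next {m} ≤m m≤ = ≤-trans (v²m≤V²y m≤) (*-monoʳ-≤ U (m≤m+n R δ)) , step-small {R} {δ} y₀≤R 4δ≤3h ≤m m≤ ,
            ((begin
              4 * (R + δ + m)               ≡⟨ eq R δ m ⟩
              4 * R + (2 * (2 * δ) + 4 * m) ≤⟨ +-monoʳ-≤ (4 * R) (+-mono-≤ (*-monoʳ-≤ 2 (<⇒≤ (≰⇒> h≰2δ))) (4m≤h m≤ R≤y₁)) ⟩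
              4 * R + (2 * h + h)           ≡⟨ cong (4 * R +_) (+-comm (2 * h) h) ⟩
              4 * R + 3 * h                 ∎) ,
             ≤-trans (*-monoʳ-≤ 4 (≤-trans (m≤m+n R δ) (m≤m+n _ m))) (m≤m+n _ _)) ,
            inj₂ R≤2y₁
            where
            open ≤-Reasoning
            eq : ∀ R δ m → 4 * (R + δ + m) ≡ 4 * R + (2 * (2 * δ) + 4 * m)
            eq = solve-∀
          longer : Win ⊎ (∃[ m ] ∃[ l′ ] (scale R ≤ m × Two l′ r (R + δ + m) R)) → Outcome
          longer (inj₁ win)                   = inj₁ win
          longer (inj₂ (m , l′ , ≤m , T′)) = loop fuel T′ (≤-trans enough (≤-trans
            (+-monoʳ-≤ (R + δ + R) (+-monoˡ-≤ fuel (≤-trans 1≤E (≤-trans (scale-≥ y₀≤R) ≤m)))) (≤-reflexive (eq (R + δ) R m fuel))))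
            where
            eq : ∀ L R m f → L + R + (m + f) ≡ L + m + R + f
            eq = solve-∀
        ...     | no ¬choice = shorter (extend (swapTwo T) (scale-≥ y₀≤R) fits choice next)
          where
          R≤y₁ : R ≤ y₁
          R≤y₁ = <⇒≤ (≰⇒> y₁≰R)
          fits : R + (R + δ) + 2 * scale R ≤ 2 * κ * y₁
          fits = ≤-trans (≤-reflexive (cong (_+ 2 * scale R) (+-comm R (R + δ)))) (≤-trans (branches≤ {R} {δ} y₀≤R 4δ≤3h) (*-monoʳ-≤ (2 * κ) R≤y₁))
          -- The required shares `1/2 - (L-R)/h` and `1/2 + (L-R)/h` add up to 1, so when one branch
          -- misses its share the other one has enough agents.
          choice : (count-r + count-l) * h + 2 * ((count-r + count-l) * (R + δ)) ≤ 2 * ((count-r + count-l) * R) + 2 * (h * count-r)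
          choice = +-cancelˡ-≤ (2 * ((count-l + count-r) * (R + δ)) + 2 * (h * count-l)) _ _ (≤-trans
            (+-monoˡ-≤ _ (<⇒≤ (≰⇒> ¬choice))) (≤-reflexive (eq count-l count-r h R δ)))
            where
            eq : ∀ x y h R δ → (x + y) * h + 2 * ((x + y) * R) + ((y + x) * h + 2 * ((y + x) * (R + δ)))
               ≡ 2 * ((x + y) * (R + δ)) + 2 * (h * x) + (2 * ((y + x) * R) + 2 * (h * y))
            eq = solve-∀
          next : ∀ {m} → scale R ≤ m → m ≤ 2 * scale R →
            v * v * m ≤ U * R × V * V * (2 * (R + (R + δ)) + m) ≤ A * (v * v) * m × Balanced (R + m) (R + δ) × (R + m ≤ 2 * y₁ ⊎ R + δ ≤ 2 * y₁)
          next {m} ≤m m≤ = v²m≤V²y m≤ ,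
            subst (λ n → V * V * (2 * n + m) ≤ A * (v * v) * m) (+-comm (R + δ) R) (step-small {R} {δ} y₀≤R 4δ≤3h ≤m m≤) ,
            (≤-trans (≤-reflexive (*-distribˡ-+ 4 R m)) (+-mono-≤ (*-monoʳ-≤ 4 (m≤m+n R δ)) (≤-trans (4m≤h m≤ R≤y₁) (m≤n*m h 3))) ,
             ≤-trans (proj₁ balance) (+-monoˡ-≤ (3 * h) (*-monoʳ-≤ 4 (m≤m+n R m)))) ,
            inj₁ (≤-trans (+-mono-≤ R≤y₁ (≤-trans (m≤y m≤) R≤y₁)) (≤-reflexive (cong (y₁ +_) (sym (+-identityʳ y₁)))))
          shorter : Win ⊎ (∃[ m ] ∃[ r′ ] (scale R ≤ m × Two r′ l (R + m) (R + δ))) → Outcome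
          shorter (inj₁ win)                   = inj₁ win
          shorter (inj₂ (m , r′ , ≤m , T′)) = loop fuel T′ (≤-trans enough (≤-trans
            (+-monoʳ-≤ (R + δ + R) (+-monoˡ-≤ fuel (≤-trans 1≤E (≤-trans (scale-≥ y₀≤R) ≤m)))) (≤-reflexive (eq (R + δ) R m fuel))))
            where
            eq : ∀ L R m f → L + R + (m + f) ≡ R + m + L + f
            eq = solve-∀

    zeros : ℕ → ℕ → Pos
    zeros n a = replicate n 0 ++ a ∷ p

    module _ (n : ℕ) (1+n≡ : suc n ≡ U * y₀) where

      branch≤ : U * y₀ ≤ U * (2 * κ * y₁)
      branch≤ = *-monoʳ-≤ U (≤-trans y₀≤y₁ (m≤n*m y₁ (2 * κ) {{m*n≢0 2 κ}}))

      fork-room : size (tree c₀) + (2 + n + n) ≤ S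
      fork-room = begin
        size (tree c₀) + (2 + n + n)                    ≡⟨ cong (size (tree c₀) +_) (trans (eq n) (cong (2 *_) 1+n≡)) ⟩
        size (tree c₀) + 2 * (U * y₀)                   ≤⟨ +-monoʳ-≤ (size (tree c₀)) (*-mono-≤ (*-mono-≤ {2} (*-monoʳ-≤ 2 1≤c) 1≤C) branch≤) ⟩
        size (tree c₀) + 2 * κ * C * (U * (2 * κ * y₁)) ≤⟨ room ⟩
        S                                               ∎
        where
        open ≤-Reasoning
        eq : ∀ n → 2 + n + n ≡ 2 * suc n
        eq = solve-∀

      fork-deep : length p + suc n ≤ Δ
      fork-deep = ≤-trans (+-monoʳ-≤ (length p) (≤-trans (≤-reflexive 1+n≡) branch≤)) deep

      abstract
        forked : Σ[ c ∈ Cfg (zeros n 0 ∷ zeros n 1 ∷ O) ] Grown c₀ (2 + n + n) c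
        forked
          with growCfg 2 c₀ far₀ (≤-trans (+-monoʳ-≤ (size (tree c₀)) (≤-trans (m≤m+n 2 n) (m≤m+n (2 + n) n))) fork-room)
                 (≤-trans (≤-reflexive (+-comm 1 (length p))) (≤-trans (+-monoʳ-≤ (length p) (s≤s z≤n)) fork-deep))
                 ((0 ∷ p) ∷ (1 ∷ p) ∷ []) ((0 , s≤s z≤n , refl) ∷ (1 , s≤s (s≤s z≤n) , refl) ∷ [])
        ... | c₁ , g₁
          with growPath n c₁ (fork-¬Below p [] [] (λ ()) ∷ Far-++ (0 ∷ []) far₀)
                 (≤-trans (≤-reflexive (trans (cong (_+ n) (size≡ g₁)) (+-assoc (size (tree c₀)) 2 n)))
                   (≤-trans (+-monoʳ-≤ (size (tree c₀)) (m≤m+n (2 + n) n)) fork-room))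
                 (≤-trans (≤-reflexive (sym (+-suc (length p) n))) fork-deep)
        ... | c₂ , g₂
          with growPath n (swapCfg c₂) (fork-¬Below p [] (replicate n 0) (λ ()) ∷ Far-++ (1 ∷ []) far₀)
                 (≤-trans (≤-reflexive (cong (_+ n) (trans (size≡ g₂) (cong (_+ n) (size≡ g₁)))))
                   (≤-trans (≤-reflexive (eq (size (tree c₀)) n)) fork-room))
                 (≤-trans (≤-reflexive (sym (+-suc (length p) n))) fork-deep)
          where
          eq : ∀ s n → s + 2 + n + n ≡ s + (2 + n + n)
          eq = solve-∀
        ... | c₃ , g₃ = swapCfg c₃ , grown
          (λ i → trans (at≡ g₃ i) (trans (at≡ g₂ i) (at≡ g₁ i)))
          (trans (moves≡ g₃) (trans (moves≡ g₂) (moves≡ g₁)))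
          (trans (size≡ g₃) (trans (cong (_+ n) (trans (size≡ g₂) (cong (_+ n) (size≡ g₁)))) (eq (size (tree c₀)) n)))
          where
          eq : ∀ s n → s + 2 + n + n ≡ s + (2 + n + n)
          eq = solve-∀

      -- The tips lie `1 + n = U y₀` edges below `p`, so an agent that arrives has paid exactly the
      -- initial potential `Z V² y₀`.
      fork : Win ⊎ Two (zeros n 0) (zeros n 1) y₀ y₀
      fork with drive (proj₁ forked)
      ... | inj₁ win = inj₁ win
      ... | inj₂ (driven c tree≡ parked unmoved cost) = inj₂ (record
        { c = c ; parked = parked ; a≢b = λ () ; l≡ = refl ; r≡ = refl
        ; |l| = trans (cong suc (length-replicate n)) 1+n≡ ; |r| = trans (cong suc (length-replicate n)) 1+n≡
        ; unmoved = still ; growth = growth ; y₀≤L = ≤-refl ; y₀≤R = ≤-refl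
        ; balance = m≤m+n _ _ , m≤m+n _ _ ; short = inj₁ (≤-trans y₀≤y₁ (m≤m+n y₁ _)) ; cost = cost′ })
        where
        g = proj₂ forked
        l r : Pos
        l = zeros n 0
        r = zeros n 1
        l≢r : l ≢ r
        l≢r eq = fork-¬Below p {0} {1} (replicate n 0) (replicate n 0) (λ ()) ([] , sym eq)
        zeros-far : ∀ a → Far (zeros n a) O
        zeros-far a = Far-++ (replicate n 0) (Far-++ (a ∷ []) far₀)
        still : ∀ i → at c₀ i ≢ p → at c i ≡ at c₀ i
        still i i≢ = trans (unmoved i (subst (_∈ l ∷ r ∷ O) (sym (at≡ g i)) (there (there (∈-tail (parked₀ i) i≢))))) (at≡ g i)
        growth : size (tree c) ≤ size (tree c₀) + C * (U * (y₀ + y₀))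
        growth = begin
          size (tree c)                      ≡⟨ trans (cong size tree≡) (size≡ g) ⟩
          size (tree c₀) + (2 + n + n)       ≡⟨ cong (size (tree c₀) +_) (trans (eq n) (trans (cong₂ _+_ 1+n≡ 1+n≡) (sym (*-distribˡ-+ U y₀ y₀)))) ⟩
          size (tree c₀) + U * (y₀ + y₀)     ≤⟨ +-monoʳ-≤ (size (tree c₀)) (m≤n*m (U * (y₀ + y₀)) C {{>-nonZero 1≤C}}) ⟩
          size (tree c₀) + C * (U * (y₀ + y₀)) ∎
          where
          open ≤-Reasoning
          eq : ∀ n → 2 + n + n ≡ suc n + suc n
          eq = solve-∀
        Ψ : ℕ
        Ψ = potential y₀ y₀
        Ψ≡ : Ψ ≡ Z * (U * y₀)
        Ψ≡ = trans (cong (_∸ loss y₀ y₀) (sym loss+initial≡gain)) (m+n∸m≡n (loss y₀ y₀) _)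
        dist-zeros : ∀ a → dist p (zeros n a) ≡ U * y₀
        dist-zeros a = trans (cong (dist p) (sym (++-assoc (replicate n 0) (a ∷ []) p)))
          (trans (dist-below p (replicate n 0 ++ a ∷ [])) (trans (length-++ (replicate n 0))
            (trans (cong (_+ 1) (length-replicate n)) (trans (+-comm n 1) 1+n≡))))
        Bound : Fin k → Set
        Bound i = φ l r Ψ (at c i) ≤ Z * dist (at c₀ i) (at c i) + Z * dist p (at c₀ i)
        bound-≢ : ∀ i → at c₀ i ≢ p → Bound i
        bound-≢ i i≢ rewrite still i i≢
          | φ-out {l} {r} Ψ (Far-≢ (zeros-far 0) (∈-tail (parked₀ i) i≢)) (Far-≢ (zeros-far 1) (∈-tail (parked₀ i) i≢)) = m≤n+m _ _
        bound-≡ : ∀ i → at c₀ i ≡ p → Bound i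
        bound-≡ i i≡ rewrite i≡ = ≤-trans (≤-reflexive (case parked i of λ
          { (here i≡′)         → trans (trans (cong (φ l r Ψ) i≡′) (φ-l Ψ l≢r)) (trans Ψ≡ (cong (Z *_) (sym (trans (cong (dist p) i≡′) (dist-zeros 0)))))
          ; (there (here i≡′)) → trans (trans (cong (φ l r Ψ) i≡′) (φ-r Ψ l≢r)) (trans Ψ≡ (cong (Z *_) (sym (trans (cong (dist p) i≡′) (dist-zeros 1)))))
          ; (there (there i∈)) → φ-out Ψ (Far-≢ (zeros-far 0) i∈) (Far-≢ (zeros-far 1) i∈) })) (m≤m+n _ _)
        bound : ∀ i → Bound i
        bound i = case at c₀ i ≟ₚ p of λ { (yes i≡) → bound-≡ i i≡ ; (no i≢) → bound-≢ i i≢ }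
        cost₀ : moves c₀ + sum (λ i → dist (at c₀ i) (at c i)) ≤ moves c
        cost₀ = subst₂ (λ m d → m + d ≤ moves c) (moves≡ g) (sum-cong-≗ (λ i → cong (λ q → dist q (at c i)) (at≡ g i))) cost
        cost′ : Z * moves c₀ + sum (λ i → φ l r Ψ (at c i)) ≤ Z * moves c + Z * sum (λ i → dist p (at c₀ i))
        cost′ = subst (λ d → Z * moves c₀ + sum (λ i → φ l r Ψ (at c i)) ≤ Z * moves c + d) (sym (*-distribˡ-sum Z (λ i → dist p (at c₀ i))))
          (sum-chain (λ i → φ l r Ψ (at c i)) (λ i → Z * dist p (at c₀ i)) (λ i → Z * dist (at c₀ i) (at c i))
            (≤-trans (≤-reflexive (trans (cong (Z * moves c₀ +_) (sym (*-distribˡ-sum Z (λ i → dist (at c₀ i) (at c i))))) (sym (*-distribˡ-+ Z _ _))))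
              (*-monoʳ-≤ Z cost₀)) bound)

    round : Outcome
    round with m≤n⇒∃[o]m+o≡n (>-nonZero⁻¹ (U * y₀) {{m*n≢0 U y₀ {{U≢0}} {{>-nonZero 1≤y₀}}}})
    ... | n , 1+n≡ with fork n 1+n≡
    ...   | inj₁ win = inj₁ win
    ...   | inj₂ T   = loop (suc (4 * y₁ + h)) T (m≤n+m _ (y₀ + y₀))

  level : (∀ {e} → E ≤ e → Strategy (v * v) C e (2 * e)) →
          ∀ {e} → 2 * κ * y₁ ≤ e → Strategy (suc v * suc v) (2 * κ * C) e (2 * e)
  level sub = repeat (λ c parked far deep room → Round.round sub c parked far deep room)

-- The whole construction and the rational bound

sum-const : ∀ {n} {f : Fin n → ℕ} {x} → (∀ i → f i ≡ x) → sum f ≡ n * x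
sum-const {zero}  f≡x = refl
sum-const {suc n} f≡x = cong₂ _+_ (f≡x Fin.zero) (sum-const (f≡x ∘ Fin.suc))

module Tower (κ V : ℕ) (32≤κ : 32 ≤ κ) (384κ≤V : 384 * κ ≤ V) where

  -- `E` is uniform in the algorithm and in the limits of the game, so these limits can afterwards
  -- be chosen in terms of `E`.
  Achieves : ℕ → ℕ → Set
  Achieves w E = ∀ {k} (alg : Algorithm k) S Δ Target {e} → E ≤ e →
    Play.Strategies.Strategy alg S Δ Target (V * V) ((w + V) * (w + V)) ((2 * κ) ^ w) e (2 * e)

  tower : ∀ w → ∃[ E ] (1 ≤ E × Achieves w E)
  tower zero    = 1 , ≤-refl , λ alg S Δ Target {e} _ → Play.Strategies.pathStrategy alg S Δ Target (V * V) e
  tower (suc w) with tower w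
  ... | E , 1≤E , sub =
    2 * κ * N.y₁ , *-mono-≤ (*-mono-≤ {1} {2} (s≤s z≤n) N.1≤c) (≤-trans N.1≤y₀ N.y₀≤y₁) ,
    λ alg S Δ Target → Level.level alg S Δ Target κ V (w + V) E 32≤κ 384κ≤V (m≤n+m V w) 1≤E ((2 * κ) ^ w)
      (>-nonZero⁻¹ ((2 * κ) ^ w) {{m^n≢0 (2 * κ) w {{m*n≢0 2 κ {{_}} {{N.c≢0}}}}}}) (sub alg S Δ Target)
    where module N = Numbers κ V (w + V) E 32≤κ 384κ≤V (m≤n+m V w) 1≤E

  -- The root is the only live leaf at the start. There is nowhere else to park, so all `k` agents
  -- pay the full rate. `(2 * κ) ^ w ≤ k` keeps the size within `k` times the depth limit, plus one.
  force : ∀ w {E} → Achieves w E → ∀ {k} (alg : Algorithm k) → (2 * κ) ^ w ≤ k →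
    Play.Win alg (1 + k * (V * V * (2 * E))) (V * V * (2 * E)) (k * ((w + V) * (w + V) * E))
  force w {E} strategy {k} alg C≤k with strategy alg S Δ Target ≤-refl c₀ (λ _ → here refl) [] ≤-refl (s≤s (*-monoˡ-≤ _ C≤k))
    where
    S Δ Target : ℕ
    S = 1 + k * (V * V * (2 * E))
    Δ = V * V * (2 * E)
    Target = k * ((w + V) * (w + V) * E)
    c₀ : Play.Cfg alg S Δ Target ([] ∷ [])
    c₀ = Play.cfg leaf [] ((refl , λ ()) ∷ []) (s≤s z≤n) z≤n
  ... | inj₁ win = win
  ... | inj₂ (m , E≤m , _ , A) = tree A.cfg′ , sched A.cfg′ , A.p′ , size≤ A.cfg′ , depth≤ A.cfg′ , long , All.head (live A.cfg′)
    where
    open Play alg (1 + k * (V * V * (2 * E))) (V * V * (2 * E)) (k * ((w + V) * (w + V) * E))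
    open Strategies (V * V)
    module A = Advance A
    ρ = (w + V) * (w + V)
    parked : ∀ i → at A.cfg′ i ≡ A.p′
    parked i with A.parked i
    ... | here eq = eq
    long : k * (ρ * E) ≤ moves A.cfg′
    long = begin
      k * (ρ * E)                                        ≤⟨ *-monoʳ-≤ k (*-monoʳ-≤ ρ E≤m) ⟩
      k * (ρ * m)                                        ≡⟨ sym (sum-const (λ i → trans (cong (wt A.p′ (ρ * m) []) (parked i)) (wt-≡ A.p′ (ρ * m) []))) ⟩
      sum (λ i → wt A.p′ (ρ * m) [] (at A.cfg′ i))       ≤⟨ A.cost ⟩
      moves A.cfg′ + sum {k} (λ i → 0)                   ≡⟨ cong (moves A.cfg′ +_) (sum-zero {k} (λ _ → refl)) ⟩
      moves A.cfg′ + 0                                   ≡⟨ +-identityʳ _ ⟩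
      moves A.cfg′                                       ∎
      where open ≤-Reasoning

-- From schedules to adversaries.

run-cong : ∀ {k} t (alg : Algorithm k) {adv adv′ : Adversary k} n → (∀ r → r < n → adv r ≡ adv′ r) → run t alg adv n ≡ run t alg adv′ n
run-cong t alg zero    adv≡ = refl
run-cong t alg (suc n) adv≡ = cong₂ (step t alg) (adv≡ n ≤-refl) (run-cong t alg n (λ r r<n → adv≡ r (m≤n⇒m≤1+n r<n)))

visited-mono : ∀ {k} t (alg : Algorithm k) adv {q m n} → m ≤′ n → q ∈ visited (run t alg adv m) → q ∈ visited (run t alg adv n)
visited-mono t alg adv ≤′-refl       q∈ = q∈
visited-mono t alg adv (≤′-step m≤n) q∈ = there (visited-mono t alg adv m≤n q∈)

-- With the newest activation first, the head of `a ∷ s` belongs to round `length s`. Rounds after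
-- the schedule are filled with `d`.
replay : ∀ {k} → Fin k → List (Fin k) → Adversary k
replay d []      r = d
replay d (a ∷ s) r = if does (r ≟ length s) then a else replay d s r

replay-< : ∀ {k} (d : Fin k) a s {r} → r < length s → replay d s r ≡ replay d (a ∷ s) r
replay-< d a s {r} r< rewrite dec-false (r ≟ length s) (<⇒≢ r<) = refl

replay-≡ : ∀ {k} (d : Fin k) a s → replay d (a ∷ s) (length s) ≡ a
replay-≡ d a s rewrite dec-true (length s ≟ length s) refl = refl

run-replay : ∀ {k} (alg : Algorithm k) S Δ Target d t s → run t alg (replay d s) (length s) ≡ Play.runL alg S Δ Target t s
run-replay alg S Δ Target d t []      = refl
run-replay alg S Δ Target d t (a ∷ s) = cong₂ (step t alg) (replay-≡ d a s)
  (trans (run-cong t alg (length s) (λ r r< → sym (replay-< d a s r<))) (run-replay alg S Δ Target d t s))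

-- Visited sets only grow, so a leaf unvisited after the whole schedule was unvisited after each of
-- its initial segments.
unexplored : ∀ {k} (alg : Algorithm k) S Δ Target → Fin k → ((t , s , q , _) : Play.Win alg S Δ Target) →
             ∀ {M} → ExploresWithin alg t M → Target < M
unexplored alg S Δ Target d (t , s , q , _ , _ , target≤ , leafq , q∉) {M} explores with M ≤? length s
... | no  M≰ = ≤-<-trans target≤ (≰⇒> M≰)
... | yes M≤ = ⊥-elim (q∉ (subst (λ σ → q ∈ visited σ) (run-replay alg S Δ Target d t s)
  (visited-mono t alg (replay d s) (≤⇒≤′ M≤) (explores (replay d s) q (_ , leafq)))))

-- Logarithms and rational estimates.

2^⌊log₂n⌋≤n : ∀ n → 1 ≤ n → 2 ^ ⌊log₂ n ⌋ ≤ n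
2^⌊log₂n⌋≤n = <-rec (λ n → 1 ≤ n → 2 ^ ⌊log₂ n ⌋ ≤ n) go
  where
  go : ∀ n → (∀ {m} → m < n → 1 ≤ m → 2 ^ ⌊log₂ m ⌋ ≤ m) → 1 ≤ n → 2 ^ ⌊log₂ n ⌋ ≤ n
  go 1 ih _ = ≤-refl
  go n@(suc (suc n′)) ih 1≤n = double ⌊log₂ n ⌋ (⌊log₂⌊n/2⌋⌋≡⌊log₂n⌋∸1 n) (ih (⌊n/2⌋<n (suc n′)) (s≤s z≤n))
    where
    double : ∀ L {l} → l ≡ L ∸ 1 → 2 ^ l ≤ ⌊ n /2⌋ → 2 ^ L ≤ n
    double zero    _    _  = 1≤n
    double (suc L) refl le = ≤-trans (*-monoʳ-≤ 2 le) (≤-trans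
      (+-monoʳ-≤ ⌊ n /2⌋ (≤-trans (≤-reflexive (+-identityʳ _)) (⌊n/2⌋≤⌈n/2⌉ n))) (≤-reflexive (⌊n/2⌋+⌈n/2⌉≡n n)))

toℚ-mkℚ : ∀ n → toℚ n ≡ mkℚ (ℤ.+ n) 0 (Coprime.sym (Coprime.1-coprimeTo n))
toℚ-mkℚ n = ℚ.normalize-coprime (Coprime.sym (Coprime.1-coprimeTo n))

toℚ-mono : ∀ {m n} → m ≤ n → toℚ m ℚ.≤ toℚ n
toℚ-mono {m} {n} m≤n rewrite toℚ-mkℚ m | toℚ-mkℚ n =
  ℚ.*≤* (subst₂ ℤ._≤_ (sym (ℤ.*-identityʳ (ℤ.+ m))) (sym (ℤ.*-identityʳ (ℤ.+ n))) (ℤ.+≤+ m≤n))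

toℚ-* : ∀ m n → toℚ (m * n) ≡ toℚ m ℚ.* toℚ n
toℚ-* m n rewrite toℚ-mkℚ m | toℚ-mkℚ n = cong (λ z → z ℚ./ 1) (ℤ.pos-* m n)

toℚ-nonNeg : ∀ n → ℚ.NonNegative (toℚ n)
toℚ-nonNeg n = ℚ.normalize-nonNeg n 1

toℚ-pos : ∀ n .{{_ : NonZero n}} → ℚ.Positive (toℚ n)
toℚ-pos n = ℚ.normalize-pos n 1

-- Replaces the given constant by a positive integer, which can enter a denominator.
archimedean : ∀ q → ∃[ K ] (q ℚ.≤ toℚ (suc K))
archimedean (mkℚ n d c) = ℤ.∣ n ∣ , subst (mkℚ n d c ℚ.≤_) (sym (toℚ-mkℚ (suc ℤ.∣ n ∣)))
  (ℚ.*≤* (ℤ.≤-trans (ℤ.≤-reflexive (ℤ.*-identityʳ n)) (ℤ.≤-trans (n≤ n) (ℤ.≤-reflexive (ℤ.pos-* (suc ℤ.∣ n ∣) (suc d))))))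
  where
  n≤ : ∀ n → n ℤ.≤ ℤ.+ (suc ℤ.∣ n ∣ * suc d)
  n≤ (ℤ.+ m)    = ℤ.+≤+ (≤-trans (n≤1+n m) (m≤m*n (suc m) (suc d)))
  n≤ -[1+ m ] = ℤ.-≤+

-- Will be used with `b = k E`, the factor common to the moves and to `n + kD`.
divide : ∀ {a b N q} .{{_ : NonZero b}} .{{_ : NonZero N}} → toℚ (a * b) ℚ.≤ q ℚ.* toℚ (N * b) →
         (ℚ.1/ toℚ N) {{ℚ.pos⇒nonZero (toℚ N) {{toℚ-pos N}}}} ℚ.* toℚ a ℚ.≤ q
divide {a} {b} {N} {q} ab≤ = ℚ.*-cancelʳ-≤-pos (toℚ (N * b)) {{toℚ-pos (N * b) {{m*n≢0 N b}}}} (ℚ.≤-trans (ℚ.≤-reflexive (begin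
  1/N ℚ.* toℚ a ℚ.* toℚ (N * b)          ≡⟨ cong₂ ℚ._*_ (ℚ.*-comm 1/N (toℚ a)) (toℚ-* N b) ⟩
  toℚ a ℚ.* 1/N ℚ.* (toℚ N ℚ.* toℚ b)    ≡⟨ ℚ.*-assoc (toℚ a) 1/N _ ⟩
  toℚ a ℚ.* (1/N ℚ.* (toℚ N ℚ.* toℚ b))  ≡⟨ cong (toℚ a ℚ.*_) (sym (ℚ.*-assoc 1/N (toℚ N) (toℚ b))) ⟩
  toℚ a ℚ.* (1/N ℚ.* toℚ N ℚ.* toℚ b)    ≡⟨ cong (λ z → toℚ a ℚ.* (z ℚ.* toℚ b)) (ℚ.*-inverseˡ (toℚ N) {{N≢0}}) ⟩
  toℚ a ℚ.* (1ℚ ℚ.* toℚ b)               ≡⟨ cong (toℚ a ℚ.*_) (ℚ.*-identityˡ (toℚ b)) ⟩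
  toℚ a ℚ.* toℚ b                        ≡⟨ sym (toℚ-* a b) ⟩
  toℚ (a * b)                            ∎)) ab≤)
  where
  open ≡-Reasoning
  N≢0 : ℚ.NonZero (toℚ N)
  N≢0 = ℚ.pos⇒nonZero (toℚ N) {{toℚ-pos N}}
  1/N : ℚ
  1/N = (ℚ.1/ toℚ N) {{N≢0}}

toℚ-pull : ∀ q m n → toℚ m ℚ.* (q ℚ.* toℚ n) ≡ q ℚ.* toℚ (m * n)
toℚ-pull q m n = trans (sym (ℚ.*-assoc (toℚ m) q (toℚ n))) (trans (cong (ℚ._* toℚ n) (ℚ.*-comm (toℚ m) q))
  (trans (ℚ.*-assoc q (toℚ m) (toℚ n)) (cong (q ℚ.*_) (sym (toℚ-* m n)))))

rescale : ∀ {L v b P q} .{{_ : NonZero b}} .{{_ : NonZero (36 * P)}} → L ≤ 6 * v → toℚ (v * v * b) ℚ.≤ q ℚ.* toℚ (P * b) →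
          (ℚ.1/ toℚ (36 * P)) {{ℚ.pos⇒nonZero (toℚ (36 * P)) {{toℚ-pos (36 * P)}}}} ℚ.* toℚ (L * L) ℚ.≤ q
rescale {L} {v} {b} {P} {q} L≤6v v²b≤ = divide {L * L} {b} {36 * P} {q} (begin
  toℚ (L * L * b)                ≤⟨ toℚ-mono {L * L * b} {36 * (v * v * b)} (≤-trans (*-monoˡ-≤ b (*-mono-≤ L≤6v L≤6v)) (≤-reflexive (eq v b))) ⟩
  toℚ (36 * (v * v * b))         ≡⟨ toℚ-* 36 (v * v * b) ⟩
  toℚ 36 ℚ.* toℚ (v * v * b)     ≤⟨ ℚ.*-monoˡ-≤-nonNeg (toℚ 36) {{toℚ-nonNeg 36}} v²b≤ ⟩
  toℚ 36 ℚ.* (q ℚ.* toℚ (P * b)) ≡⟨ toℚ-pull q 36 (P * b) ⟩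
  q ℚ.* toℚ (36 * (P * b))       ≡⟨ cong (λ n → q ℚ.* toℚ n) (sym (*-assoc 36 P b)) ⟩
  q ℚ.* toℚ (36 * P * b)         ∎)
  where
  open ℚ.≤-Reasoning
  eq : ∀ v b → 6 * v * (6 * v) * b ≡ 36 * (v * v * b)
  eq = solve-∀

-- Choice of the constants and the final bound.

abstract
  V₀ : ℕ
  V₀ = 384 * 32

  384*32≤V₀ : 384 * 32 ≤ V₀
  384*32≤V₀ = ≤-refl

V₀²≢0 : NonZero (V₀ * V₀)
V₀²≢0 = m*n≢0 V₀ V₀ {{V₀≢0}} {{V₀≢0}}
  where
  V₀≢0 : NonZero V₀
  V₀≢0 = >-nonZero (≤-trans (s≤s z≤n) 384*32≤V₀)

open Tower 32 V₀ ≤-refl 384*32≤V₀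

-- The number of levels is `⌊L/6⌋` because `64 = 2^6`. `V₀` absorbs the remainder, so small `k` need
-- no separate treatment.
⌊log₂⌋≤ : ∀ n → ⌊log₂ n ⌋ ≤ 6 * (⌊log₂ n ⌋ / 6 + V₀)
⌊log₂⌋≤ n = begin
  L                  ≡⟨ m≡m%n+[m/n]*n L 6 ⟩
  L % 6 + L / 6 * 6  ≤⟨ +-monoˡ-≤ (L / 6 * 6) (≤-trans (<⇒≤ (m%n<n L 6)) (*-monoʳ-≤ 6 {1} {V₀} (≤-trans (s≤s z≤n) 384*32≤V₀))) ⟩
  6 * V₀ + L / 6 * 6 ≡⟨ eq V₀ (L / 6) ⟩
  6 * (L / 6 + V₀)   ∎
  where
  open ≤-Reasoning
  L = ⌊log₂ n ⌋
  eq : ∀ V w → 6 * V + w * 6 ≡ 6 * (w + V)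
  eq = solve-∀

64^[log/6]≤ : ∀ n → 1 ≤ n → (2 * 32) ^ (⌊log₂ n ⌋ / 6) ≤ n
64^[log/6]≤ n 1≤n = begin
  64 ^ (L / 6)      ≡⟨ ^-*-assoc 2 6 (L / 6) ⟩
  2 ^ (6 * (L / 6)) ≤⟨ ^-monoʳ-≤ 2 (≤-trans (≤-reflexive (*-comm 6 (L / 6))) (m/n*n≤m L 6)) ⟩
  2 ^ L             ≤⟨ 2^⌊log₂n⌋≤n n 1≤n ⟩
  n                 ∎
  where
  open ≤-Reasoning
  L = ⌊log₂ n ⌋

module _ {q C : ℚ} (0≤q : 0ℚ ℚ.≤ q) {K} (C≤K : C ℚ.≤ toℚ (suc K)) {k′} (alg : Algorithm (suc k′))
  (explores : ∀ t → ExploresInAtMost alg t (C ℚ.* (q ℚ.* toℚ (size t + suc k′ * depth t)))) where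

  private
    k = suc k′

  competitive : ∀ {w E} → 1 ≤ E → Achieves w E → (2 * 32) ^ w ≤ k →
                toℚ ((w + V₀) * (w + V₀) * (k * E)) ℚ.≤ q ℚ.* toℚ (suc K * (5 * (V₀ * V₀)) * (k * E))
  competitive {w} {E} 1≤E strategy C≤k = fromWin (force w strategy alg C≤k)
    where
    open ℚ.≤-Reasoning
    v Y : ℕ
    v = w + V₀
    Y = 5 * (V₀ * V₀) * (k * E)
    fromWin : Play.Win alg (1 + k * (V₀ * V₀ * (2 * E))) (V₀ * V₀ * (2 * E)) (k * (v * v * E)) →
              toℚ (v * v * (k * E)) ℚ.≤ q ℚ.* toℚ (suc K * (5 * (V₀ * V₀)) * (k * E))
    fromWin win@(t , _ , _ , size≤ , depth≤ , _) with explores t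
    ... | M , M≤ , within = begin
      toℚ (v * v * (k * E))                     ≤⟨ toℚ-mono {v * v * (k * E)} {M} (≤-trans (≤-reflexive (eq v k E))
                                                     (<⇒≤ (unexplored alg _ _ _ Fin.zero win {M} within))) ⟩
      toℚ M                                     ≤⟨ M≤ ⟩
      C ℚ.* (q ℚ.* toℚ X)                       ≤⟨ ℚ.*-monoʳ-≤-nonNeg (q ℚ.* toℚ X) {{qX≥0}} C≤K ⟩
      toℚ (suc K) ℚ.* (q ℚ.* toℚ X)             ≤⟨ ℚ.*-monoˡ-≤-nonNeg (toℚ (suc K)) {{toℚ-nonNeg (suc K)}}
                                                     (ℚ.*-monoˡ-≤-nonNeg q {{q≥0}} (toℚ-mono {X} {Y} X≤Y)) ⟩
      toℚ (suc K) ℚ.* (q ℚ.* toℚ Y)             ≡⟨ toℚ-pull q (suc K) Y ⟩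
      q ℚ.* toℚ (suc K * Y)                     ≡⟨ cong (λ n → q ℚ.* toℚ n) (sym (*-assoc (suc K) (5 * (V₀ * V₀)) (k * E))) ⟩
      q ℚ.* toℚ (suc K * (5 * (V₀ * V₀)) * (k * E)) ∎
      where
      X : ℕ
      X = size t + k * depth t
      eq : ∀ v k E → v * v * (k * E) ≡ k * (v * v * E)
      eq = solve-∀
      q≥0 : ℚ.NonNegative q
      q≥0 = ℚ.nonNegative 0≤q
      qX≥0 : ℚ.NonNegative (q ℚ.* toℚ X)
      qX≥0 = ℚ.nonNeg*nonNeg⇒nonNeg q {{q≥0}} (toℚ X) {{toℚ-nonNeg X}}
      X≤Y : X ≤ Y
      -- In terms of `k V₀² E`: 2 for the size, 2 for `k` times the depth, and 1 for the root node.
      X≤Y = ≤-trans (+-mono-≤ size≤ (*-monoʳ-≤ k depth≤)) (≤-trans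
        (+-monoˡ-≤ (k * (V₀ * V₀ * (2 * E))) (+-monoˡ-≤ (k * (V₀ * V₀ * (2 * E)))
          (>-nonZero⁻¹ (k * (V₀ * V₀ * E)) {{m*n≢0 k (V₀ * V₀ * E) {{_}} {{m*n≢0 (V₀ * V₀) E {{V₀²≢0}} {{>-nonZero 1≤E}}}}}})))
        (≤-reflexive (eq′ k (V₀ * V₀) E)))
        where
        eq′ : ∀ k U E → k * (U * E) + k * (U * (2 * E)) + k * (U * (2 * E)) ≡ 5 * U * (k * E)
        eq′ = solve-∀

theorem4 : (c : ℕ → ℚ) → (∀ k → 0ℚ ℚ.≤ c k) →
    (∃[ C ] ((k : ℕ) → ∃[ alg ] ((t : Tree) →
    ExploresInAtMost {k} alg t (C ℚ.* (c k ℚ.* toℚ (size t + k * depth t)))))) →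
    ∃[ B ] ((0ℚ ℚ.< B) × ∃[ k₀ ] ((k : ℕ) → k ≥ k₀ →
    B ℚ.* toℚ (⌊log₂ k ⌋ * ⌊log₂ k ⌋) ℚ.≤ c k))
theorem4 c 0≤c (C , explorer) with archimedean C
-- The threshold is `k₀ = 1`: the adversary needs an agent to activate.
... | K , C≤K = (ℚ.1/ toℚ N) {{ℚ.pos⇒nonZero (toℚ N) {{toℚ-pos N}}}} ,
                ℚ.positive⁻¹ _ {{ℚ.1/pos⇒pos (toℚ N) {{toℚ-pos N}}}} , 1 , bound
  where
  P N : ℕ
  P = suc K * (5 * (V₀ * V₀))
  N = 36 * P
  instance
    N≢0 : NonZero N
    N≢0 = m*n≢0 36 P {{_}} {{m*n≢0 (suc K) (5 * (V₀ * V₀)) {{_}} {{m*n≢0 5 (V₀ * V₀) {{_}} {{V₀²≢0}}}}}}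
  bound : (k : ℕ) → k ≥ 1 →
    (ℚ.1/ toℚ N) {{ℚ.pos⇒nonZero (toℚ N) {{toℚ-pos N}}}} ℚ.* toℚ (⌊log₂ k ⌋ * ⌊log₂ k ⌋) ℚ.≤ c k
  bound (suc k′) 1≤k = fromStrategy (tower (⌊log₂ suc k′ ⌋ / 6))
    where
    fromStrategy : ∃[ E ] (1 ≤ E × Achieves (⌊log₂ suc k′ ⌋ / 6) E) →
      (ℚ.1/ toℚ N) {{ℚ.pos⇒nonZero (toℚ N) {{toℚ-pos N}}}} ℚ.* toℚ (⌊log₂ suc k′ ⌋ * ⌊log₂ suc k′ ⌋) ℚ.≤ c (suc k′)
    fromStrategy (E , 1≤E , strategy) =
      rescale {⌊log₂ suc k′ ⌋} {⌊log₂ suc k′ ⌋ / 6 + V₀} {suc k′ * E} {P} {{m*n≢0 (suc k′) E {{_}} {{>-nonZero 1≤E}}}} (⌊log₂⌋≤ (suc k′))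
        (competitive (0≤c (suc k′)) {K} C≤K (proj₁ (explorer (suc k′))) (proj₂ (explorer (suc k′)))
          {⌊log₂ suc k′ ⌋ / 6} 1≤E strategy (64^[log/6]≤ (suc k′) 1≤k))
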